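{- Let $(K,v)$ be a Henselian valued field, let $\theta\in\overline{K}$ have degree $n>1$ over $K$, and let $F$ be the minimal polynomial of $\theta$ over $K$. (1) Let $[A_0,A_1,\dots,A_{r-1},A_r=\{\theta\}]$ be an Okutsu sequence of $\theta$ and set $\Phi_\ell=\{\operatorname{Irr}_K(\alpha)\mid \alpha\in A_\ell\}$ for $0\le \ell\le r$. Then $[\Phi_0,\dots,\Phi_{r-1},\Phi_r=\{F\}]$ is an Okutsu frame of $F$. (2) Conversely, let $[\Phi_0,\dots,\Phi_{r-1},\Phi_r=\{F\}]$ be an Okutsu frame of $F$. For each $0\le\ell\le r$, if $\Phi_\ell=(\phi_i)_{i\in I_\ell}$, take $A_\ell=(\alpha_i)_{i\in I_\ell}$, where $\alpha_i\in\overline{K}$ is a root of $\phi_i$ chosen so that $v(\theta-\alpha_i)=d(\phi_i)$ for all $i\in I_\ell$ (in particular $A_r=\{\theta\}$). Then $[A_0,A_1,\dots,A_{r-1},A_r=\{\theta\}]$ is an Okutsu sequence of $\theta$.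
   Context: $(K,v)$ is a Henselian valued field of arbitrary rank; $v$ also denotes its unique extension to a fixed algebraic closure $\overline{K}$; $\Gamma=v(\overline{K}^*)$. $\operatorname{Irr}(K)$ is the set of monic irreducible polynomials in $K[x]$, $\operatorname{Irr}_K(\alpha)$ is the minimal polynomial of $\alpha$ over $K$, and $\deg_K\alpha=\deg \operatorname{Irr}_K(\alpha)$. Weight and distance (relative to $\theta$): for nonconstant $g\in K[x]$, $w(g)=v(g(\theta))/\deg(g)\in\Gamma\cup\{\infty\}$; for monic nonconstant $g\in K[x]$, $d(g)=\max\{v(\theta-\alpha)\mid \alpha\in\overline{K},\ g(\alpha)=0\}\in\Gamma\cup\{\infty\}$. For an integer $1<m\le n$: $K[x]_m$ is the set of monic $g\in K[x]$ with $1\le\deg g<m$; $W_m=w(K[x]_m)$; $V_m=\{v(\theta-\beta)\mid\beta\in\overline{K},\ \deg_K\beta<m\}$. A nonempty subset of $\overline{K}$ (resp. of $\operatorname{Irr}(K)$) has a common degree if all its elements have the same degree over $K$ (resp. the same degree). An Okutsu sequence of $\theta$ is a finite list $[A_0,\dots,A_{r-1},A_r=\{\theta\}]$ of common-degree subsets of $\overline{K}$, of degrees $1=m_0<m_1<\cdots<m_r=n$ ($m_\ell=\deg_KA_\ell$), such that for all $0\le\ell<r$: (OS0) for all $\beta\in\overline{K}$ with $\deg_K\beta<m_{\ell+1}$ there is $\alpha\in A_\ell$ with $v(\theta-\beta)\le v(\theta-\alpha)$; (OS1) $\#A_\ell=1$ whenever $\max(V_{m_{\ell+1}})$ exists; (OS2)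 if $\max(V_{m_{\ell+1}})$ does not exist, then $A_\ell$ is totally ordered with respect to the ordering $\alpha<\alpha'\Leftrightarrow v(\theta-\alpha)<v(\theta-\alpha')$; (OS3) for all $\alpha\in A_\ell$, $\gamma\in A_{\ell+1}$: $v(\theta-\alpha)<v(\theta-\gamma)$. An Okutsu frame of $F$ is a finite list $[\Phi_0,\dots,\Phi_{r-1},\Phi_r=\{F\}]$ of common-degree subsets of $\operatorname{Irr}(K)$, of degrees $1=m_0<m_1<\cdots<m_r=n$ ($m_\ell=\deg\Phi_\ell$), such that for all $0\le\ell<r$: (OF0) for every $g\in K[x]_{m_{\ell+1}}$ there is $\phi\in\Phi_\ell$ with $w(g)\le w(\phi)$; (OF1) $\#\Phi_\ell=1$ whenever $\max(W_{m_{\ell+1}})$ exists; (OF2) if $\max(W_{m_{\ell+1}})$ does not exist, then $\Phi_\ell$ is totally ordered with respect to the ordering $\phi<\phi'\Leftrightarrow w(\phi)<w(\phi')$; (OF3) for all $\phi\in\Phi_\ell$, $\varphi\in\Phi_{\ell+1}$: $w(\phi)<w(\varphi)$.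
   Formalization: In (1), (OF2) can fail as stated when some α in A_ℓ has a conjugate closer to θ; it is proved only under the added hypothesis v(θ-α)=d(Irr_K(α)) for all α in every A_ℓ. All other frame conditions in (1), and (2), are proved as stated. -}

module Defs where

open import Level using (Level; _⊔_) renaming (suc to lsuc)
open import Algebra.Bundles using (CommutativeRing; CommutativeSemiring; AbelianGroup; RawSemiring)
open import Algebra.Morphism.Structures using (IsRingHomomorphism)
import Algebra.Definitions.RawMonoid as RawMonoidDefs
import Algebra.Definitions.RawSemiring as RawSemiringDefs
import Algebra.Properties.Group as GroupProperties
import Algebra.Properties.Ring as RingProperties
open import Data.Empty using (⊥-elim)
open import Data.Fin.Base using (Fin; zero; suc; inject₁; fromℕ)
open import Data.List.Base using (List; []; _∷_; [_]; _++_; map; foldr)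
open import Data.Nat.Base as ℕ using (ℕ; zero; suc; NonZero)
open import Data.Product.Base using (Σ-syntax; ∃; ∃-syntax; _×_; _,_; proj₁; proj₂)
open import Data.Sum.Base using (_⊎_)
open import Data.Vec.Base using (Vec; _∷_; replicate; toList)
open import Function.Bundles using (_⇔_; Equivalence)
open import Relation.Binary.Core using (Rel)
open import Relation.Binary.Definitions using (_Respects_)
open import Relation.Binary.PropositionalEquality.Core using (_≡_)
open import Relation.Binary.Structures using (IsTotalOrder)
import Relation.Binary.Construct.Add.Supremum.Equality as SupEq
import Relation.Binary.Construct.Add.Supremum.NonStrict as SupOrder
import Relation.Binary.Construct.NonStrictToStrict as Strict
open import Relation.Nullary.Construct.Add.Supremum using (_⁺; ⊤⁺) renaming ([_] to fin)
open import Relation.Nullary.Negation.Core using (¬_)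
open import Relation.Unary using (Pred; _∈_; _⊆_; _≐_)

private
  variable
    c ℓ g₁ g₂ g₃ p : Level

------------------------------------------------------------------------
-- Fields

record Field c ℓ : Set (lsuc (c ⊔ ℓ)) where
  field
    commutativeRing : CommutativeRing c ℓ

  open CommutativeRing commutativeRing public

  field
    0≉1     : ¬ 0# ≈ 1#
    inverse : ∀ x → ¬ x ≈ 0# → ∃[ y ] x * y ≈ 1#

------------------------------------------------------------------------
-- Polynomials, as lists of coefficients starting with the constant one.
-- Trailing zeros are allowed, hence the equality _≈ₚ_.

module Polynomial (R : CommutativeRing c ℓ) where
  open CommutativeRing R

  Poly : Set c
  Poly = List Carrier

  coeff : Poly → ℕ → Carrier
  coeff []      _       = 0#
  coeff (a ∷ _) zero    = a
  coeff (_ ∷ f) (suc i) = coeff f i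

  infix 4 _≈ₚ_
  _≈ₚ_ : Rel Poly ℓ
  f ≈ₚ g = ∀ i → coeff f i ≈ coeff g i

  infixl 6 _+ₚ_
  _+ₚ_ : Poly → Poly → Poly
  []      +ₚ g       = g
  (a ∷ f) +ₚ []      = a ∷ f
  (a ∷ f) +ₚ (b ∷ g) = a + b ∷ f +ₚ g

  infixl 7 _*ₚ_
  _*ₚ_ : Poly → Poly → Poly
  []      *ₚ g = []
  (a ∷ f) *ₚ g = map (a *_) g +ₚ (0# ∷ f *ₚ g)

  polyRawSemiring : RawSemiring c ℓ
  polyRawSemiring = record
    { Carrier = Poly
    ; _≈_     = _≈ₚ_
    ; _+_     = _+ₚ_
    ; _*_     = _*ₚ_
    ; 0#      = []
    ; 1#      = [ 1# ]
    }

  eval : Poly → Carrier → Carrier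
  eval f x = foldr (λ a y → a + x * y) 0# f

  -- The monic nonconstant polynomial xⁿ + aₙ₋₁ xⁿ⁻¹ + ⋯ + a₀ of degree
  -- n = suc degree-1 is given by its lower coefficients a₀ , … , aₙ₋₁.
  record Monic : Set c where
    constructor monic
    field
      degree-1 : ℕ
      lower    : Vec Carrier (suc degree-1)

  open Monic public

  deg : Monic → ℕ
  deg f = suc (degree-1 f)

  toPoly : Monic → Poly
  toPoly f = toList (lower f) ++ [ 1# ]

  infix 4 _≈ₘ_
  _≈ₘ_ : Rel Monic ℓ
  f ≈ₘ g = toPoly f ≈ₚ toPoly g

  -- A monic irreducible polynomial is nonconstant, so Irr is all of
  -- Irr(K) when R = K.
  Irr : Pred Monic (c ⊔ ℓ)
  Irr f = RawSemiringDefs.Irreducible polyRawSemiring (toPoly f)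

AlgebraicallyClosed : Field c ℓ → Set (c ⊔ ℓ)
AlgebraicallyClosed L = ∀ (f : Monic) → ∃[ x ] eval (toPoly f) x ≈ 0#
  where
  open Field L
  open Polynomial commutativeRing

record AlgebraicExtension (K : Field c ℓ) : Set (lsuc (c ⊔ ℓ)) where
  private
    module K = Field K
  open Polynomial K.commutativeRing

  field
    overfield : Field c ℓ

  open Field overfield

  field
    ι                  : K.Carrier → Carrier
    isRingHomomorphism : IsRingHomomorphism K.rawRing rawRing ι

  infix 9 _⟨_⟩
  _⟨_⟩ : Monic → Carrier → Carrier
  f ⟨ x ⟩ = Polynomial.eval commutativeRing (map ι (toPoly f)) x

  field
    algebraic : ∀ x → ∃[ f ] f ⟨ x ⟩ ≈ 0#

  IsMinimalPolynomial : Carrier → Monic → Set (c ⊔ ℓ)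
  IsMinimalPolynomial x f =
    f ⟨ x ⟩ ≈ 0# × (∀ g → g ⟨ x ⟩ ≈ 0# → deg f ℕ.≤ deg g)

  HasDegree : Carrier → ℕ → Set (c ⊔ ℓ)
  HasDegree x n = ∃[ f ] IsMinimalPolynomial x f × deg f ≡ n

------------------------------------------------------------------------
-- Valuations

record OrderedAbelianGroup g₁ g₂ g₃ : Set (lsuc (g₁ ⊔ g₂ ⊔ g₃)) where
  field
    abelianGroup : AbelianGroup g₁ g₂

  open AbelianGroup abelianGroup public
    renaming (_∙_ to _+_; ε to 0#; _⁻¹ to -_)

  infix 4 _≤_
  field
    _≤_          : Rel Carrier g₃
    isTotalOrder : IsTotalOrder _≈_ _≤_
    +-monoˡ-≤    : ∀ {x y} z → x ≤ y → x + z ≤ y + z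

  open RawMonoidDefs rawMonoid public using () renaming (_×_ to _·_)

  Carrier∞ : Set g₁
  Carrier∞ = Carrier ⁺

  infixl 6 _+∞_
  _+∞_ : Carrier∞ → Carrier∞ → Carrier∞
  fin x +∞ fin y = fin (x + y)
  fin _ +∞ ⊤⁺    = ⊤⁺
  ⊤⁺    +∞ _     = ⊤⁺

  open SupEq _≈_ public using () renaming (_≈⁺_ to _≈∞_)
  open SupOrder _≤_ public using () renaming (_≤⁺_ to _≤∞_)
  open Strict _≈∞_ _≤∞_ public using () renaming (_<_ to _<∞_)

  IsMax : Pred Carrier∞ p → Carrier∞ → Set _
  IsMax S x = x ∈ S × (∀ {y} → y ∈ S → y ≤∞ x)

  HasMax : Pred Carrier∞ p → Set _
  HasMax S = ∃[ x ] IsMax S x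

record Valuation (K : Field c ℓ) (Γ : OrderedAbelianGroup g₁ g₂ g₃) :
                 Set (c ⊔ ℓ ⊔ g₁ ⊔ g₂ ⊔ g₃) where
  open Field K
  open OrderedAbelianGroup Γ using (Carrier∞; _≈∞_; _≤∞_; _+∞_)
    renaming (0# to 0Γ)

  field
    v         : Carrier → Carrier∞
    v-cong    : ∀ {x y} → x ≈ y → v x ≈∞ v y
    v-∞       : ∀ {x} → v x ≈∞ ⊤⁺ ⇔ x ≈ 0#
    v-*       : ∀ x y → v (x * y) ≈∞ v x +∞ v y
    -- v (x + y) ≥ min (v x) (v y)
    v-+       : ∀ x y → v x ≤∞ v (x + y) ⊎ v y ≤∞ v (x + y)

  Integral : Pred Carrier (g₁ ⊔ g₃)
  Integral x = fin 0Γ ≤∞ v x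

-- Any two valuations on an algebraic extension of K whose valuation rings
-- lie over that of v have the same valuation ring.  Their value groups
-- are arbitrary.  Only uniqueness is asked for: a prolongation always
-- exists, by Chevalley's theorem.
Henselian : {K : Field c ℓ} {Γ : OrderedAbelianGroup g₁ g₂ g₃} →
            Valuation K Γ → Set _
Henselian {c} {ℓ} {g₁} {g₂} {g₃} {K} v =
  (E : AlgebraicExtension K) →
  let open AlgebraicExtension E in
  (Γ₁ Γ₂ : OrderedAbelianGroup g₁ g₂ g₃)
  (v₁ : Valuation overfield Γ₁) (v₂ : Valuation overfield Γ₂) →
  (∀ a → Integral v₁ (ι a) ⇔ Integral v a) →
  (∀ a → Integral v₂ (ι a) ⇔ Integral v a) →
  ∀ x → Integral v₁ x ⇔ Integral v₂ x
  where open Valuation using (Integral)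

-- An algebraic closure K̄ of K with a valuation v̄ that extends v and has
-- v̄(K̄*) = Γ.
record ValuedAlgebraicClosure {K : Field c ℓ} {Γ : OrderedAbelianGroup g₁ g₂ g₃}
                              (vK : Valuation K Γ) :
                              Set (lsuc (c ⊔ ℓ) ⊔ g₁ ⊔ g₂ ⊔ g₃) where
  private
    module K = Field K
    module Γ = OrderedAbelianGroup Γ
    module vK = Valuation vK
  open OrderedAbelianGroup Γ using (Carrier∞; _≈∞_; _+∞_; _·_)

  field
    extension : AlgebraicExtension K

  open AlgebraicExtension extension public

  field
    algebraicallyClosed : AlgebraicallyClosed overfield
    valuation           : Valuation overfield Γ

  open Field overfield
  open Valuation valuation public

  field
    v-extends : ∀ a → v (ι a) ≈∞ vK.v a
    v-onto    : ∀ γ → ∃[ x ] v x ≈∞ fin γ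

  private
    open Polynomial commutativeRing
    open SupEq Γ._≈_ using (⊤⁺≈⊤⁺; ≈⁺-sym; ≈⁺-trans) renaming ([_] to lift)
    open import Relation.Binary.Reasoning.Setoid setoid

    infixr 8 _^_
    _^_ : Carrier → ℕ → Carrier
    _^_ = RawSemiringDefs._^_ (CommutativeSemiring.rawSemiring commutativeSemiring)

    X^ : ∀ k b → eval (toList (replicate k 0#) ++ [ 1# ]) b ≈ b ^ k
    X^ zero    b = trans (+-congˡ (zeroʳ b)) (+-identityʳ 1#)
    X^ (suc k) b = trans (+-identityˡ _) (*-congˡ (X^ k b))

    root : ∀ k a → ∃[ b ] b ^ suc k ≈ a
    root k a with algebraicallyClosed (monic k (- a ∷ replicate k 0#))
    ... | b , f[b]≈0 = b , (begin
      b ^ suc k                ≈⟨ *-congˡ (X^ k b) ⟨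
      y                        ≈⟨ +-identityˡ y ⟨
      0# + y                   ≈⟨ +-congʳ (-‿inverseʳ a) ⟨
      (a + - a) + y            ≈⟨ +-assoc a (- a) y ⟩
      a + (- a + y)            ≈⟨ +-congˡ f[b]≈0 ⟩
      a + 0#                   ≈⟨ +-identityʳ a ⟩
      a                        ∎)
      where y = b * eval (toList (replicate k 0#) ++ [ 1# ]) b

    v1 : v 1# ≈∞ fin Γ.0#
    v1 with v 1# | v-* 1# 1# | v-cong (*-identityˡ 1#) | Equivalence.to (v-∞ {1#})
    ... | ⊤⁺    | _  | _  | to = ⊥-elim (0≉1 (sym (to ⊤⁺≈⊤⁺)))
    ... | fin γ | e₁ | e₂ | _ with ≈⁺-trans Γ.trans (≈⁺-sym Γ.sym e₁) e₂
    ...   | lift γ+γ≈γ = lift (GroupProperties.identityˡ-unique Γ.group γ γ γ+γ≈γ)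

    v-^ : ∀ k {b δ} → v b ≈∞ fin δ → v (b ^ k) ≈∞ fin (k · δ)
    v-^ zero        _ = v1
    v-^ (suc k) {b} e = ≈⁺-trans Γ.trans (v-* b (b ^ k)) (+-fin e (v-^ k e))
      where
      +-fin : ∀ {x y γ δ} → x ≈∞ fin γ → y ≈∞ fin δ → x +∞ y ≈∞ fin (γ Γ.+ δ)
      +-fin (lift x) (lift y) = lift (Γ.∙-cong x y)

  divisible : ∀ n .{{_ : NonZero n}} γ → ∃[ δ ] n · δ Γ.≈ γ
  divisible (suc k) γ with v-onto γ
  ... | a , va with root k a
  ...   | b , bⁿ≈a with v b in vb
  ...     | fin δ = δ , unlift (trans∞ (sym∞ (v-^ (suc k) vb≈)) (trans∞ (v-cong bⁿ≈a) va))
    where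
    trans∞ = ≈⁺-trans Γ.trans
    sym∞   = ≈⁺-sym Γ.sym

    unlift : ∀ {x y} → fin x ≈∞ fin y → x Γ.≈ y
    unlift (lift e) = e

    vb≈ : v b ≈∞ fin δ
    vb≈ rewrite vb = lift Γ.refl
  ...     | ⊤⁺ = ⊥-elim (⊤≉fin (trans∞ (sym∞ (Equivalence.from v-∞ a≈0)) va))
    where
    trans∞ = ≈⁺-trans Γ.trans
    sym∞   = ≈⁺-sym Γ.sym

    ⊤≉fin : ∀ {x} → ¬ ⊤⁺ ≈∞ fin x
    ⊤≉fin ()

    vb≈ : v b ≈∞ ⊤⁺
    vb≈ rewrite vb = ⊤⁺≈⊤⁺

    a≈0 : a ≈ 0#
    a≈0 = trans (sym bⁿ≈a) (trans (*-congʳ (Equivalence.to v-∞ vb≈)) (zeroˡ _))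

  infixl 7 _/_
  _/_ : Carrier∞ → (n : ℕ) .{{_ : NonZero n}} → Carrier∞
  fin γ / n = fin (proj₁ (divisible n γ))
  ⊤⁺    / n = ⊤⁺

------------------------------------------------------------------------
-- Okutsu sequences and Okutsu frames of θ, with minimal polynomial F

module Okutsu
  {K : Field c ℓ} {Γ : OrderedAbelianGroup g₁ g₂ g₃} {vK : Valuation K Γ}
  (K̄ : ValuedAlgebraicClosure vK)
  (θ : Field.Carrier (ValuedAlgebraicClosure.overfield K̄))
  (F : Polynomial.Monic (Field.commutativeRing K))
  where

  open ValuedAlgebraicClosure K̄
  open Field overfield using (Carrier; _≈_; _-_; 0#)
  open Polynomial (Field.commutativeRing K)
  open OrderedAbelianGroup Γ using (Carrier∞; _≈∞_; _≤∞_; _<∞_; IsMax; HasMax)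

  w : Monic → Carrier∞
  w g = v (g ⟨ θ ⟩) / deg g

  -- d(g) = δ
  IsDistance : Monic → Carrier∞ → Set _
  IsDistance g = IsMax λ δ → ∃[ α ] g ⟨ α ⟩ ≈ 0# × δ ≈∞ v (θ - α)

  W : ℕ → Pred Carrier∞ _
  W m γ = ∃[ g ] deg g ℕ.< m × γ ≈∞ w g

  V : ℕ → Pred Carrier∞ _
  V m γ = ∃[ β ] (∃[ k ] HasDegree β k × k ℕ.< m) × γ ≈∞ v (θ - β)

  record IsOkutsuSequence {p} (r : ℕ) (A : Fin (suc r) → Pred Carrier p) :
                          Set (c ⊔ ℓ ⊔ g₁ ⊔ g₂ ⊔ g₃ ⊔ p) where
    field
      A-resp-≈ : ∀ i → A i Respects _≈_
      A-last   : A (fromℕ r) ≐ (_≈ θ)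

      m        : Fin (suc r) → ℕ
      nonempty : ∀ i → ∃[ α ] α ∈ A i
      degree   : ∀ i {α} → α ∈ A i → HasDegree α (m i)
      m-first  : m zero ≡ 1
      m-mono   : ∀ (l : Fin r) → m (inject₁ l) ℕ.< m (suc l)
      m-last   : m (fromℕ r) ≡ deg F

      OS0 : ∀ (l : Fin r) {β k} → HasDegree β k → k ℕ.< m (suc l) →
            ∃[ α ] α ∈ A (inject₁ l) × v (θ - β) ≤∞ v (θ - α)
      OS1 : ∀ (l : Fin r) → HasMax (V (m (suc l))) →
            ∀ {α α′} → α ∈ A (inject₁ l) → α′ ∈ A (inject₁ l) → α ≈ α′
      OS2 : ∀ (l : Fin r) → ¬ HasMax (V (m (suc l))) →
            ∀ {α α′} → α ∈ A (inject₁ l) → α′ ∈ A (inject₁ l) →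
            v (θ - α) <∞ v (θ - α′) ⊎ α ≈ α′ ⊎ v (θ - α′) <∞ v (θ - α)
      OS3 : ∀ (l : Fin r) {α γ} → α ∈ A (inject₁ l) → γ ∈ A (suc l) →
            v (θ - α) <∞ v (θ - γ)

  -- All of the definition of an Okutsu frame except for OF2.  It is kept
  -- apart because OF2 does not carry over from an Okutsu sequence A to
  -- its minimal polynomials: if some α ∈ A has a conjugate closer to θ,
  -- then Irr(α) may have the same weight as Irr(α′) for another α′ ∈ A.
  record IsPreOkutsuFrame {p} (r : ℕ) (Φ : Fin (suc r) → Pred Monic p) :
                          Set (c ⊔ ℓ ⊔ g₁ ⊔ g₂ ⊔ g₃ ⊔ p) where
    field
      Φ⊆Irr    : ∀ i → Φ i ⊆ Irr
      Φ-resp-≈ : ∀ i → Φ i Respects _≈ₘ_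
      Φ-last   : Φ (fromℕ r) ≐ (_≈ₘ F)

      m        : Fin (suc r) → ℕ
      nonempty : ∀ i → ∃[ φ ] φ ∈ Φ i
      degree   : ∀ i {φ} → φ ∈ Φ i → deg φ ≡ m i
      m-first  : m zero ≡ 1
      m-mono   : ∀ (l : Fin r) → m (inject₁ l) ℕ.< m (suc l)
      m-last   : m (fromℕ r) ≡ deg F

      OF0 : ∀ (l : Fin r) g → deg g ℕ.< m (suc l) →
            ∃[ φ ] φ ∈ Φ (inject₁ l) × w g ≤∞ w φ
      OF1 : ∀ (l : Fin r) → HasMax (W (m (suc l))) →
            ∀ {φ φ′} → φ ∈ Φ (inject₁ l) → φ′ ∈ Φ (inject₁ l) → φ ≈ₘ φ′
      OF3 : ∀ (l : Fin r) {φ ψ} → φ ∈ Φ (inject₁ l) → ψ ∈ Φ (suc l) →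
            w φ <∞ w ψ

  record IsOkutsuFrame {p} (r : ℕ) (Φ : Fin (suc r) → Pred Monic p) :
                       Set (c ⊔ ℓ ⊔ g₁ ⊔ g₂ ⊔ g₃ ⊔ p) where
    field
      isPreOkutsuFrame : IsPreOkutsuFrame r Φ

    open IsPreOkutsuFrame isPreOkutsuFrame public

    field
      OF2 : ∀ (l : Fin r) → ¬ HasMax (W (m (suc l))) →
            ∀ {φ φ′} → φ ∈ Φ (inject₁ l) → φ′ ∈ Φ (inject₁ l) →
            w φ <∞ w φ′ ⊎ φ ≈ₘ φ′ ⊎ w φ′ <∞ w φ

  -- { Irr_K(α) ∣ α ∈ A }
  MinimalPolynomials : Pred Carrier p → Pred Monic _
  MinimalPolynomials A φ = ∃[ α ] α ∈ A × IsMinimalPolynomial α φ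

  -- v(θ - α) = d(Irr_K(α)) for all α ∈ A
  AttainsDistance : Pred Carrier p → Set _
  AttainsDistance A =
    ∀ {α φ} → α ∈ A → IsMinimalPolynomial α φ → IsDistance φ (v (θ - α))

  record RootChoice (Φ : Pred Monic p) : Set (c ⊔ ℓ ⊔ g₁ ⊔ g₂ ⊔ g₃ ⊔ p) where
    field
      root     : ∀ φ → φ ∈ Φ → Carrier
      cong     : ∀ {φ φ′} (i : φ ∈ Φ) (i′ : φ′ ∈ Φ) → φ ≈ₘ φ′ → root φ i ≈ root φ′ i′
      isRoot   : ∀ φ (i : φ ∈ Φ) → φ ⟨ root φ i ⟩ ≈ 0#
      distance : ∀ φ (i : φ ∈ Φ) → IsDistance φ (v (θ - root φ i))

    Roots : Pred Carrier _
    Roots α = ∃[ φ ] Σ[ i ∈ φ ∈ Φ ] α ≈ root φ i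

{-# OPTIONS --safe #-}

-- Put D(β) = v(θ - β) and N(β) = v(F(β)).  Conjugate elements α, β over K
-- satisfy v(h(α)) = v(h(β)) for all h ∈ K[x]: the Henselian property is
-- applied to K(α) and to the two valuations induced by the embeddings of
-- K(α) that send α to α and to β.  The value of the resultant of F and a
-- monic g is then n v(g(θ)), and also the sum of N over the roots of g.  So
-- n w(φ) = N(β) if φ is the minimal polynomial of β, and every g has a root
-- β with n w(g) ≤ N(β).
--
-- Moreover N(β) is the sum of the v(β - θᵢ) over the roots θᵢ of F.  If β is
-- a conjugate nearest to θ, then v(β - θᵢ) ≤ D(β) for all i, as the Newton
-- polygons of φ(θ + Y) and φ(θᵢ + Y) agree.  For D(β) ≤ D(β′) the
-- ultrametric inequality then gives v(β - θᵢ) ≤ v(β′ - θᵢ) term by term, so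
-- on nearest conjugates N, and with it the weight, is a strictly increasing
-- function of D.

module Submission where

open import Defs
open import Algebra.Bundles using (CommutativeMonoid; CommutativeRing; RawRing)
open import Algebra.Definitions.RawMagma using (_,_)
import Algebra.Definitions.RawSemiring as RawSemiringDefs
import Algebra.Morphism.RingMonomorphism as RingMonomorphism
open import Algebra.Morphism.Structures using (IsRingHomomorphism; IsRingMonomorphism)
open import Axiom.ExcludedMiddle using (ExcludedMiddle)
open import Data.Fin.Base using (Fin; zero; suc; inject₁; fromℕ)
open import Data.List.Base using ([]; _∷_; [_]; _++_; map; length)
open import Data.List.Properties using (length-map)
open import Data.Maybe.Base using (Maybe; just; nothing)
open import Data.Nat.Base as ℕ using (ℕ; zero; suc; z≤n; s≤s; _<_)
open import Data.Nat.Induction using (<-rec)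
import Data.Nat.Properties as ℕ
open import Data.Product.Base using (∃; ∃-syntax; Σ-syntax; _×_; _,_; proj₁; proj₂)
open import Data.Sum.Base as Sum using (_⊎_; inj₁; inj₂)
open import Data.Vec.Base as Vec using (Vec; []; _∷_; replicate; toList)
import Data.Vec.Functional as Vector
open import Data.Vec.Properties using (length-toList)
open import Function.Base using (_∘_; id)
open import Function.Bundles using (_⇔_; Equivalence; mk⇔)
open import Level using (_⊔_)
open import Relation.Binary.Bundles using (TotalOrder)
import Relation.Binary.Construct.Add.Supremum.Equality as SupEq
import Relation.Binary.Construct.Add.Supremum.NonStrict as SupOrder
import Relation.Binary.Construct.NonStrictToStrict as Strict
open import Relation.Binary.PropositionalEquality.Core as ≡ using (_≡_)
open import Relation.Nullary.Construct.Add.Supremum using (⊤⁺) renaming ([_] to fin)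
open import Relation.Nullary.Decidable using (yes; no; decidable-stable)
open import Relation.Nullary.Negation.Core using (¬_; contradiction)
open import Relation.Unary using (Pred; _∈_)

-- No automorphism of `K̄` is constructed. The usual proof that no root `θᵢ` of `F` is closer to a
-- nearest conjugate `β` than `θ` is moves `θᵢ` to `θ` by an automorphism. Here conjugacy is
-- available only as the equality `v(h(α)) = v(h(β))` for `h` over `K`. This is why Newton polygons
-- enter: the coefficients of `φ(θ + Y)` are polynomials in `θ` over `K`, so their values survive
-- the replacement of `θ` by `θᵢ`. Roots are counted with multiplicity throughout, so `F` may be
-- inseparable.
--
-- The Henselian property compares valuation rings only. To get equal values, some positive multiple
-- of `v(x)` is shown to lie in the value group of `K`, and a power of `x` is rescaled to a unit.
--
-- The comparison of `β` with `β′` assumes that `β` is nearest among its conjugates, but nothing of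
-- the kind about `β′`. Members of an Okutsu sequence need not be nearest, so the proof passes to a
-- nearest conjugate and lets OS0 dominate it by a member of the sequence.

-- Integer coefficients are pairs (a , b) standing for a - b.
module IntegerCoefficientSolver {c ℓ} (R : CommutativeRing c ℓ) where
  open CommutativeRing R
  open import Algebra.Solver.Ring.AlmostCommutativeRing
    using (_-Raw-AlmostCommutative⟶_; fromCommutativeRing)
  open import Algebra.Properties.Semiring.Mult semiring
    using (×-homo-+; ×1-homo-*; ×-congˡ) renaming (_×_ to _·_)
  open import Algebra.Properties.Ring ring
    using (-‿distribˡ-*; -‿distribʳ-*; -0#≈0#; -‿involutive; ⁻¹-anti-homo-//)
  open import Algebra.Properties.AbelianGroup +-abelianGroup using (⁻¹-∙-comm)
  open import Algebra.Properties.CommutativeSemigroup +-commutativeSemigroup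
    using (interchange)
  open import Relation.Binary.Reasoning.Setoid setoid

  private
    ⟦_⟧ℤ : ℕ × ℕ → Carrier
    ⟦ a , b ⟧ℤ = a · 1# - b · 1#

    ℤ-ring : RawRing _ _
    ℤ-ring = record
      { Carrier = ℕ × ℕ
      ; _≈_     = λ x y → ⟦ x ⟧ℤ ≈ ⟦ y ⟧ℤ
      ; _+_     = λ (a , b) (c , d) → a ℕ.+ c , b ℕ.+ d
      ; _*_     = λ (a , b) (c , d) → a ℕ.* c ℕ.+ b ℕ.* d , a ℕ.* d ℕ.+ b ℕ.* c
      ; -_      = λ (a , b) → b , a
      ; 0#      = 0 , 0
      ; 1#      = 1 , 0
      }

    sub-+ : ∀ a b c d → (a + c) - (b + d) ≈ (a - b) + (c - d)
    sub-+ a b c d = trans (+-congˡ (sym (⁻¹-∙-comm b d))) (interchange a c (- b) (- d))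

    sub-* : ∀ a b c d → (a * c + b * d) - (a * d + b * c) ≈ (a - b) * (c - d)
    sub-* a b c d = begin
      (a * c + b * d) - (a * d + b * c)               ≈⟨ sub-+ _ _ _ _ ⟩
      (a * c - a * d) + (b * d - b * c)               ≈⟨ +-congˡ (+-comm _ _) ⟩
      (a * c - a * d) + (- (b * c) + b * d)
        ≈⟨ +-cong (+-congˡ (-‿distribʳ-* a d)) (+-cong (-‿distribˡ-* b c)
          (trans (sym (-‿involutive _)) (trans (-‿cong (-‿distribˡ-* b d)) (-‿distribʳ-* (- b) d)))) ⟩
      (a * c + a * - d) + (- b * c + - b * - d)
        ≈⟨ +-cong (distribˡ a c (- d)) (distribˡ (- b) c (- d)) ⟨
      a * (c - d) + - b * (c - d)                     ≈⟨ distribʳ (c - d) a (- b) ⟨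
      (a - b) * (c - d)                               ∎

    homomorphism : ℤ-ring -Raw-AlmostCommutative⟶ fromCommutativeRing R
    homomorphism = record
      { ⟦_⟧    = ⟦_⟧ℤ
      ; +-homo = λ (a , b) (c , d) →
          trans (+-cong (×-homo-+ 1# a c) (-‿cong (×-homo-+ 1# b d))) (sub-+ _ _ _ _)
      ; *-homo = λ (a , b) (c , d) →
          trans (+-cong (expand a c b d) (-‿cong (expand a d b c))) (sub-* _ _ _ _)
      ; -‿homo = λ (a , b) → sym (⁻¹-anti-homo-// (a · 1#) (b · 1#))
      ; 0-homo = -‿inverseʳ 0#
      ; 1-homo = trans (+-congˡ -0#≈0#) (trans (+-identityʳ _) (+-identityʳ _))
      }
      where
      expand : ∀ a c b d → (a ℕ.* c ℕ.+ b ℕ.* d) · 1# ≈ a · 1# * c · 1# + b · 1# * d · 1#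
      expand a c b d = trans (×-homo-+ 1# (a ℕ.* c) (b ℕ.* d)) (+-cong (×1-homo-* a c) (×1-homo-* b d))

    -- The solver asks only for a sound test. Equality of formal differences, `a + d = c + b` in ℕ,
    -- is decidable and gives equal images in every characteristic.
    _≟_ : (x y : ℕ × ℕ) → Maybe (⟦ x ⟧ℤ ≈ ⟦ y ⟧ℤ)
    (a , b) ≟ (c , d) with a ℕ.+ d ℕ.≟ c ℕ.+ b
    ... | no  _   = nothing
    ... | yes a+d≡c+b = just (begin
      A - B                  ≈⟨ +-identityʳ _ ⟨
      (A - B) + 0#           ≈⟨ +-congˡ (-‿inverseʳ D) ⟨
      (A - B) + (D - D)      ≈⟨ sub-+ A B D D ⟨
      (A + D) - (B + D)
        ≈⟨ +-cong (trans (sym (×-homo-+ 1# a d)) (trans (×-congˡ a+d≡c+b) (×-homo-+ 1# c b))) (-‿cong (+-comm B D)) ⟩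
      (C + B) - (D + B)      ≈⟨ sub-+ C D B B ⟩
      (C - D) + (B - B)      ≈⟨ +-congˡ (-‿inverseʳ B) ⟩
      (C - D) + 0#           ≈⟨ +-identityʳ _ ⟩
      C - D                  ∎)
      where
      A = a · 1#
      B = b · 1#
      C = c · 1#
      D = d · 1#

  open import Algebra.Solver.Ring ℤ-ring (fromCommutativeRing R) homomorphism _≟_ public

-- The ordered monoid Γ ∪ {∞}

module ExtendedValueGroup {g₁ g₂ g₃} (Γ : OrderedAbelianGroup g₁ g₂ g₃) where
  private module Γ = OrderedAbelianGroup Γ
  open OrderedAbelianGroup Γ using (Carrier∞; _≈∞_; _≤∞_; _<∞_; _+∞_)
  open SupEq Γ._≈_ using (⊤⁺≈⊤⁺; ≈⁺-isEquivalence) renaming ([_] to fin-cong)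
  open SupOrder Γ._≤_ using (_≤⊤⁺; ≤⁺-isTotalOrder) renaming ([_] to fin-mono)

  +∞-commutativeMonoid : CommutativeMonoid g₁ (g₁ ⊔ g₂)
  +∞-commutativeMonoid = record
    { Carrier = Carrier∞
    ; _≈_     = _≈∞_
    ; _∙_     = _+∞_
    ; ε       = fin Γ.0#
    ; isCommutativeMonoid = record
      { isMonoid = record
        { isSemigroup = record
          { isMagma = record
            { isEquivalence = ≈⁺-isEquivalence Γ.isEquivalence
            ; ∙-cong        = cong }
          ; assoc = assoc }
        ; identity = idˡ , idʳ }
      ; comm = comm } }
    where
    cong : ∀ {x y u v} → x ≈∞ y → u ≈∞ v → x +∞ u ≈∞ y +∞ v
    cong (fin-cong p) (fin-cong q) = fin-cong (Γ.∙-cong p q)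
    cong (fin-cong p) ⊤⁺≈⊤⁺        = ⊤⁺≈⊤⁺
    cong ⊤⁺≈⊤⁺        q            = ⊤⁺≈⊤⁺

    assoc : ∀ x y z → (x +∞ y) +∞ z ≈∞ x +∞ (y +∞ z)
    assoc ⊤⁺      y       z       = ⊤⁺≈⊤⁺
    assoc (fin x) ⊤⁺      z       = ⊤⁺≈⊤⁺
    assoc (fin x) (fin y) ⊤⁺      = ⊤⁺≈⊤⁺
    assoc (fin x) (fin y) (fin z) = fin-cong (Γ.assoc x y z)

    comm : ∀ x y → x +∞ y ≈∞ y +∞ x
    comm (fin x) (fin y) = fin-cong (Γ.comm x y)
    comm (fin x) ⊤⁺      = ⊤⁺≈⊤⁺
    comm ⊤⁺      (fin y) = ⊤⁺≈⊤⁺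
    comm ⊤⁺      ⊤⁺      = ⊤⁺≈⊤⁺

    idˡ : ∀ x → fin Γ.0# +∞ x ≈∞ x
    idˡ (fin x) = fin-cong (Γ.identityˡ x)
    idˡ ⊤⁺      = ⊤⁺≈⊤⁺

    idʳ : ∀ x → x +∞ fin Γ.0# ≈∞ x
    idʳ (fin x) = fin-cong (Γ.identityʳ x)
    idʳ ⊤⁺      = ⊤⁺≈⊤⁺

  open CommutativeMonoid +∞-commutativeMonoid public
    using ()
    renaming ( refl to ≈-refl; sym to ≈-sym; trans to ≈-trans; reflexive to ≈-reflexive
             ; ∙-cong to +-cong; ∙-congˡ to +-congˡ; ∙-congʳ to +-congʳ
             ; assoc to +-assoc; comm to +-comm
             ; identityˡ to +-identityˡ; identityʳ to +-identityʳ; setoid to ≈-setoid )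
  open import Algebra.Properties.CommutativeMonoid.Sum +∞-commutativeMonoid public
    using (sum; sum-cong-≋; sum-replicate; ∑-comm)
  open import Algebra.Properties.CommutativeMonoid.Mult +∞-commutativeMonoid public
    using () renaming (_×_ to _·∞_; ×-congʳ to ·-congʳ; ×-assocˡ to ·-assocˡ)

  ≤∞-totalOrder : TotalOrder g₁ (g₁ ⊔ g₂) (g₁ ⊔ g₃)
  ≤∞-totalOrder = record { isTotalOrder = ≤⁺-isTotalOrder Γ.isTotalOrder }

  open TotalOrder ≤∞-totalOrder public
    using (total; poset; ≤-respˡ-≈; ≤-respʳ-≈)
    renaming ( refl to ≤-refl; reflexive to ≤-reflexive; trans to ≤-trans
             ; antisym to ≤-antisym )
  open import Relation.Binary.Reasoning.PartialOrder poset

  ≤⊤ : ∀ x → x ≤∞ ⊤⁺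
  ≤⊤ = _≤⊤⁺

  ⊤≤⇒≈⊤ : ∀ {x} → ⊤⁺ ≤∞ x → x ≈∞ ⊤⁺
  ⊤≤⇒≈⊤ ⊤≤x = ≤-antisym (≤⊤ _) ⊤≤x

  ≰⇒≥ : ∀ {x y} → ¬ x ≤∞ y → y ≤∞ x
  ≰⇒≥ {x} {y} x≰y with total x y
  ... | inj₁ x≤y = contradiction x≤y x≰y
  ... | inj₂ y≤x = y≤x

  ≰⇒> : ∀ {x y} → ¬ x ≤∞ y → y <∞ x
  ≰⇒> x≰y = ≰⇒≥ x≰y , λ y≈x → x≰y (≤-reflexive (≈-sym y≈x))

  <⇒≱ : ∀ {x y} → x <∞ y → ¬ y ≤∞ x
  <⇒≱ = Strict.<⇒≱ _≈∞_ _≤∞_ ≤-antisym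

  +-monoʳ-≤ : ∀ z {x y} → x ≤∞ y → x +∞ z ≤∞ y +∞ z
  +-monoʳ-≤ (fin z) (fin-mono x≤y) = fin-mono (Γ.+-monoˡ-≤ z x≤y)
  +-monoʳ-≤ ⊤⁺      (fin-mono x≤y) = ≤⊤ _
  +-monoʳ-≤ z       (x ≤⊤⁺)        = ≤⊤ _

  +-monoˡ-≤ : ∀ z {x y} → x ≤∞ y → z +∞ x ≤∞ z +∞ y
  +-monoˡ-≤ z {x} {y} x≤y = begin
    z +∞ x  ≈⟨ +-comm z x ⟩
    x +∞ z  ≤⟨ +-monoʳ-≤ z x≤y ⟩
    y +∞ z  ≈⟨ +-comm y z ⟩
    z +∞ y  ∎

  +-mono-≤ : ∀ {x y u v} → x ≤∞ y → u ≤∞ v → x +∞ u ≤∞ y +∞ v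
  +-mono-≤ {y = y} {u} x≤y u≤v = ≤-trans (+-monoʳ-≤ u x≤y) (+-monoˡ-≤ y u≤v)

  -- Finiteness is phrased as `¬ ⊤⁺ ≤∞ z` because it then follows by transitivity from any strict
  -- inequality `¬ y ≤∞ z`.
  +-cancelʳ-≤ : ∀ {z} → ¬ ⊤⁺ ≤∞ z → ∀ {x y} → x +∞ z ≤∞ y +∞ z → x ≤∞ y
  +-cancelʳ-≤ {⊤⁺}    z<⊤               = contradiction ≤-refl z<⊤
  +-cancelʳ-≤ {fin z} _   {x} {⊤⁺}    _ = ≤⊤ x
  +-cancelʳ-≤ {fin z} _   {fin x} {fin y} x+z≤y+z = begin
    fin x                              ≈⟨ cancel (fin x) ⟩
    (fin x +∞ fin z) +∞ fin (Γ.- z)    ≤⟨ +-monoʳ-≤ (fin (Γ.- z)) x+z≤y+z ⟩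
    (fin y +∞ fin z) +∞ fin (Γ.- z)    ≈⟨ cancel (fin y) ⟨
    fin y                              ∎
    where
    cancel : ∀ x → x ≈∞ (x +∞ fin z) +∞ fin (Γ.- z)
    cancel x = ≈-sym (≈-trans (+-assoc x (fin z) (fin (Γ.- z)))
                     (≈-trans (+-congˡ {x} (fin-cong (Γ.inverseʳ z))) (+-identityʳ x)))

  +-cancelˡ-≤ : ∀ {z} → ¬ ⊤⁺ ≤∞ z → ∀ {x y} → z +∞ x ≤∞ z +∞ y → x ≤∞ y
  +-cancelˡ-≤ {z} z<⊤ {x} {y} le =
    +-cancelʳ-≤ z<⊤ (≤-respˡ-≈ (+-comm z x) (≤-respʳ-≈ (+-comm z y) le))

  +-mono-≰ : ∀ {x y u v} → ¬ y ≤∞ x → u ≤∞ v → ¬ ⊤⁺ ≤∞ u → ¬ y +∞ v ≤∞ x +∞ u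
  +-mono-≰ {y = y} y≰x u≤v u<⊤ le = y≰x (+-cancelʳ-≤ u<⊤ (≤-trans (+-monoˡ-≤ y u≤v) le))

  +-cancel-inverse : ∀ {x y z u} → x ≈∞ y +∞ z → y +∞ u ≈∞ fin Γ.0# → x +∞ u ≈∞ z
  +-cancel-inverse {x} {y} {z} {u} x≈y+z y+u≈0 = ≈-trans (+-congʳ x≈y+z)
    (≈-trans (+-congʳ (+-comm y z)) (≈-trans (+-assoc z y u)
    (≈-trans (+-congˡ {z} y+u≈0) (+-identityʳ z))))

  +-finite : ∀ {x y} → ¬ ⊤⁺ ≤∞ x → ¬ ⊤⁺ ≤∞ y → ¬ ⊤⁺ ≤∞ x +∞ y
  +-finite {⊤⁺}            x<⊤ _   _ = x<⊤ ≤-refl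
  +-finite {fin _} {⊤⁺}    _   y<⊤ _ = y<⊤ ≤-refl
  +-finite {fin _} {fin _} _   _   ()

  ·-mono-≤ : ∀ n {x y} → x ≤∞ y → n ·∞ x ≤∞ n ·∞ y
  ·-mono-≤ zero    x≤y = ≤-refl
  ·-mono-≤ (suc n) x≤y = +-mono-≤ x≤y (·-mono-≤ n x≤y)

  ·-finite : ∀ n {x} → ¬ ⊤⁺ ≤∞ x → ¬ ⊤⁺ ≤∞ n ·∞ x
  ·-finite zero    _   ()
  ·-finite (suc n) x<⊤ = +-finite x<⊤ (·-finite n x<⊤)

  -- A totally ordered group is torsion-free: if `y ≤ x`, then `n` of the copies of `y` on the right
  -- can be raised to `x` and cancelled.
  ·-cancel-≤ : ∀ n {x y} → suc n ·∞ x ≤∞ suc n ·∞ y → x ≤∞ y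
  ·-cancel-≤ n {x} {⊤⁺}    _  = ≤⊤ x
  ·-cancel-≤ n {⊤⁺} {fin y} le = contradiction le (·-finite (suc n) {fin y} λ ())
  ·-cancel-≤ n {fin x} {fin y} le with total (fin x) (fin y)
  ... | inj₁ x≤y = x≤y
  ... | inj₂ y≤x = +-cancelʳ-≤ (·-finite n {fin x} λ ())
                     (≤-trans le (+-monoˡ-≤ (fin y) (·-mono-≤ n y≤x)))

  ·-cancel-≈ : ∀ n {x y} → suc n ·∞ x ≈∞ suc n ·∞ y → x ≈∞ y
  ·-cancel-≈ n e = ≤-antisym (·-cancel-≤ n (≤-reflexive e)) (·-cancel-≤ n (≤-reflexive (≈-sym e)))

  ·-fin : ∀ n γ → n ·∞ fin γ ≡ fin (n Γ.· γ)
  ·-fin zero    γ = ≡.refl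
  ·-fin (suc n) γ = ≡.cong (fin γ +∞_) (·-fin n γ)

  sum-mono-≤ : ∀ {n} {f g : Fin n → Carrier∞} → (∀ i → f i ≤∞ g i) → sum f ≤∞ sum g
  sum-mono-≤ {zero}  f≤g = ≤-refl
  sum-mono-≤ {suc n} f≤g = +-mono-≤ (f≤g zero) (sum-mono-≤ (f≤g ∘ suc))

  sum-finite : ∀ {n} {f : Fin n → Carrier∞} → (∀ i → ¬ ⊤⁺ ≤∞ f i) → ¬ ⊤⁺ ≤∞ sum f
  sum-finite {zero}  f<⊤ ()
  sum-finite {suc n} f<⊤ = +-finite (f<⊤ zero) (sum-finite (f<⊤ ∘ suc))

  sum-⊤ : ∀ {n} (f : Fin n → Carrier∞) i → ⊤⁺ ≤∞ f i → ⊤⁺ ≤∞ sum f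
  sum-⊤ f zero    ⊤≤f = ≤-respʳ-≈ (+-congʳ (≈-sym (⊤≤⇒≈⊤ ⊤≤f))) ≤-refl
  sum-⊤ f (suc i) ⊤≤f = ≤-respʳ-≈ (+-comm (sum (f ∘ suc)) (f zero))
    (≤-respʳ-≈ (+-congʳ (≈-sym (⊤≤⇒≈⊤ (sum-⊤ (f ∘ suc) i ⊤≤f)))) ≤-refl)

  -- Finiteness of the smaller terms keeps the one strict inequality from being absorbed by ∞.
  sum-mono-≰ : ∀ {n} {f g : Fin n → Carrier∞} → (∀ i → f i ≤∞ g i) → (∀ i → ¬ ⊤⁺ ≤∞ f i) →
               ∃[ i ] ¬ g i ≤∞ f i → ¬ sum g ≤∞ sum f
  sum-mono-≰ {suc n} f≤g f<⊤ (zero  , g≰f) =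
    +-mono-≰ g≰f (sum-mono-≤ (f≤g ∘ suc)) (sum-finite (f<⊤ ∘ suc))
  sum-mono-≰ {suc n} {f} {g} f≤g f<⊤ (suc i , g≰f) le =
    +-mono-≰ (sum-mono-≰ (f≤g ∘ suc) (f<⊤ ∘ suc) (i , g≰f)) (f≤g zero) (f<⊤ zero)
      (≤-respˡ-≈ (+-comm (g zero) _) (≤-respʳ-≈ (+-comm (f zero) _) le))

  argmax : ∀ {n} (f : Fin (suc n) → Carrier∞) → ∃[ i ] ∀ j → f j ≤∞ f i
  argmax {zero}  f = zero , λ { zero → ≤-refl }
  argmax {suc n} f with argmax (f ∘ suc)
  ... | i , max with total (f zero) (f (suc i))
  ...   | inj₁ le = suc i , λ { zero → le ; (suc j) → max j }
  ...   | inj₂ ge = zero  , λ { zero → ≤-refl ; (suc j) → ≤-trans (max j) ge }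

  -- The largest term is at least the average. With `x = ⊤⁺` this says that an infinite sum has an
  -- infinite term, which is how roots are found among the factors.
  average-≤ : ∀ {n x} (f : Fin (suc n) → Carrier∞) → suc n ·∞ x ≤∞ sum f → ∃[ i ] x ≤∞ f i
  average-≤ {n} {x} f le with argmax f
  ... | i , max = i , ·-cancel-≤ n (begin
    suc n ·∞ x           ≤⟨ le ⟩
    sum f                ≤⟨ sum-mono-≤ max ⟩
    sum {suc n} (λ _ → f i) ≈⟨ sum-replicate (suc n) ⟩
    suc n ·∞ f i         ∎)

-- Polynomial functions

module PolynomialFunctions {c ℓ} (K : Field c ℓ) (E : AlgebraicExtension K) where
  private module K = Field K
  open AlgebraicExtension E public
  open Field overfield public
    using (Carrier; _≈_; _+_; _*_; -_; _-_; 0#; 1#; refl; sym; trans; setoid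
          ; +-cong; +-congˡ; +-congʳ; *-cong; *-congˡ; *-congʳ; +-identityˡ; +-identityʳ
          ; *-identityˡ; *-identityʳ; zeroˡ; zeroʳ; -‿cong; -‿inverseʳ; +-comm; *-comm; *-assoc
          ; 0≉1; inverse; commutativeRing; ring)
  private module L = Polynomial commutativeRing
  open Polynomial K.commutativeRing public
  open IntegerCoefficientSolver commutativeRing using (solve; _:=_; _:+_; _:*_; _:-_; :-_)
  open import Algebra.Properties.Ring ring using (-0#≈0#)
  open import Relation.Binary.Reasoning.Setoid setoid
  module ι = IsRingHomomorphism isRingHomomorphism

  -- Identities between polynomials over `K` are checked on values in the overfield, which spares
  -- the ring laws of `Poly`. Over an algebraically closed overfield `ev-injective` returns to
  -- coefficients.
  ev : Poly → Carrier → Carrier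
  ev p x = L.eval (map ι p) x

  -- Unlike toPoly, this includes the constant polynomial 1.
  mon : ∀ {n} → Vec K.Carrier n → Poly
  mon xs = toList xs ++ [ K.1# ]

  ≉0-cancel : ∀ {x y} → ¬ x ≈ 0# → x * y ≈ 0# → y ≈ 0#
  ≉0-cancel {x} {y} x≉0 xy≈0 with inverse x x≉0
  ... | z , xz≈1 = begin
    y            ≈⟨ *-identityˡ y ⟨
    1# * y       ≈⟨ *-congʳ xz≈1 ⟨
    (x * z) * y  ≈⟨ solve 3 (λ x y z → (x :* z) :* y := z :* (x :* y)) refl x y z ⟩
    z * (x * y)  ≈⟨ *-congˡ xy≈0 ⟩
    z * 0#       ≈⟨ zeroʳ z ⟩
    0#           ∎

  ι-≉0 : ∀ {a} → ¬ a K.≈ K.0# → ¬ ι a ≈ 0#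
  ι-≉0 {a} a≉0 ιa≈0 with K.inverse a a≉0
  ... | b , ab≈1 = 0≉1 (begin
    0#             ≈⟨ zeroˡ _ ⟨
    0# * ι b       ≈⟨ *-congʳ ιa≈0 ⟨
    ι a * ι b      ≈⟨ ι.*-homo a b ⟨
    ι (a K.* b)    ≈⟨ ι.⟦⟧-cong ab≈1 ⟩
    ι K.1#         ≈⟨ ι.1#-homo ⟩
    1#             ∎)

  ev-const : ∀ a x → ev [ a ] x ≈ ι a
  ev-const a x = trans (+-congˡ (zeroʳ x)) (+-identityʳ _)

  ev-1 : ∀ x → ev [ K.1# ] x ≈ 1#
  ev-1 x = trans (ev-const K.1# x) ι.1#-homo

  ev-+ : ∀ p q x → ev (p +ₚ q) x ≈ ev p x + ev q x
  ev-+ []      q       x = sym (+-identityˡ _)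
  ev-+ (a ∷ p) []      x = sym (+-identityʳ _)
  ev-+ (a ∷ p) (b ∷ q) x = begin
    ι (a K.+ b) + x * ev (p +ₚ q) x           ≈⟨ +-cong (ι.+-homo a b) (*-congˡ (ev-+ p q x)) ⟩
    (ι a + ι b) + x * (ev p x + ev q x)
      ≈⟨ solve 5 (λ a b x p q → (a :+ b) :+ x :* (p :+ q) := (a :+ x :* p) :+ (b :+ x :* q))
           refl (ι a) (ι b) x (ev p x) (ev q x) ⟩
    (ι a + x * ev p x) + (ι b + x * ev q x)   ∎

  ev-scale : ∀ a p x → ev (map (a K.*_) p) x ≈ ι a * ev p x
  ev-scale a []      x = sym (zeroʳ _)
  ev-scale a (b ∷ p) x = begin
    ι (a K.* b) + x * ev (map (a K.*_) p) x  ≈⟨ +-cong (ι.*-homo a b) (*-congˡ (ev-scale a p x)) ⟩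
    ι a * ι b + x * (ι a * ev p x)
      ≈⟨ solve 4 (λ a b x p → a :* b :+ x :* (a :* p) := a :* (b :+ x :* p)) refl (ι a) (ι b) x (ev p x) ⟩
    ι a * (ι b + x * ev p x)                 ∎

  ev-shift : ∀ p x → ev (K.0# ∷ p) x ≈ x * ev p x
  ev-shift p x = trans (+-congʳ ι.0#-homo) (+-identityˡ _)

  ev-* : ∀ p q x → ev (p *ₚ q) x ≈ ev p x * ev q x
  ev-* []      q x = sym (zeroˡ _)
  ev-* (a ∷ p) q x = begin
    ev (map (a K.*_) q +ₚ (K.0# ∷ p *ₚ q)) x     ≈⟨ ev-+ (map (a K.*_) q) (K.0# ∷ p *ₚ q) x ⟩
    ev (map (a K.*_) q) x + ev (K.0# ∷ p *ₚ q) x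
      ≈⟨ +-cong (ev-scale a q x) (trans (ev-shift (p *ₚ q) x) (*-congˡ (ev-* p q x))) ⟩
    ι a * ev q x + x * (ev p x * ev q x)
      ≈⟨ solve 4 (λ a x p q → a :* q :+ x :* (p :* q) := (a :+ x :* p) :* q) refl (ι a) x (ev p x) (ev q x) ⟩
    (ι a + x * ev p x) * ev q x                  ∎

  infix 8 -ₚ_
  -ₚ_ : Poly → Poly
  -ₚ p = map (λ a → K.- a) p

  ev-neg : ∀ p x → ev (-ₚ p) x ≈ - ev p x
  ev-neg []      x = sym -0#≈0#
  ev-neg (a ∷ p) x = begin
    ι (K.- a) + x * ev (-ₚ p) x   ≈⟨ +-cong (ι.-‿homo a) (*-congˡ (ev-neg p x)) ⟩
    - ι a + x * - ev p x
      ≈⟨ solve 3 (λ a x p → :- a :+ x :* :- p := :- (a :+ x :* p)) refl (ι a) x (ev p x) ⟩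
    - (ι a + x * ev p x)          ∎

  ev-sub : ∀ p q x → ev (p +ₚ -ₚ q) x ≈ ev p x - ev q x
  ev-sub p q x = trans (ev-+ p (-ₚ q) x) (+-congˡ (ev-neg q x))

  ev-zero : ∀ p → (∀ i → coeff p i K.≈ K.0#) → ∀ x → ev p x ≈ 0#
  ev-zero []      _   x = refl
  ev-zero (a ∷ p) p≈0 x = begin
    ι a + x * ev p x  ≈⟨ +-cong (trans (ι.⟦⟧-cong (p≈0 0)) ι.0#-homo) (*-congˡ (ev-zero p (p≈0 ∘ suc) x)) ⟩
    0# + x * 0#       ≈⟨ trans (+-identityˡ _) (zeroʳ x) ⟩
    0#                ∎

  ev-cong : ∀ p q → p ≈ₚ q → ∀ x → ev p x ≈ ev q x
  ev-cong []      q       p≈q x = sym (ev-zero q (K.sym ∘ p≈q) x)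
  ev-cong (a ∷ p) []      p≈q x = ev-zero (a ∷ p) p≈q x
  ev-cong (a ∷ p) (b ∷ q) p≈q x = +-cong (ι.⟦⟧-cong (p≈q 0)) (*-congˡ (ev-cong p q (p≈q ∘ suc) x))

  ev-respʳ : ∀ p {x y} → x ≈ y → ev p x ≈ ev p y
  ev-respʳ []      _   = refl
  ev-respʳ (a ∷ p) x≈y = +-congˡ (*-cong x≈y (ev-respʳ p x≈y))

  coeff-sub : ∀ p q i → coeff (p +ₚ -ₚ q) i K.≈ coeff p i K.- coeff q i
  coeff-sub []      []      i       = K.sym (K.-‿inverseʳ K.0#)
  coeff-sub []      (b ∷ q) zero    = K.sym (K.+-identityˡ _)
  coeff-sub []      (b ∷ q) (suc i) = coeff-sub [] q i
  coeff-sub (a ∷ p) []      i       = K.sym (K.trans (K.+-congˡ K-0≈0) (K.+-identityʳ _))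
    where
    open import Algebra.Properties.Ring K.ring using () renaming (-0#≈0# to K-0≈0)
  coeff-sub (a ∷ p) (b ∷ q) zero    = K.refl
  coeff-sub (a ∷ p) (b ∷ q) (suc i) = coeff-sub p q i

  -- Induction on the Horner form of the dividend: if `p = q f + r`, then
  -- `a + x p = x q f + (a + x r)`, and `a + x r` has degree at most `n`, so that subtracting one
  -- constant multiple of `f` finishes.
  division : ∀ {n} (f : Vec K.Carrier n) p →
             ∃[ q ] Σ[ r ∈ Vec K.Carrier n ] ∀ x → ev p x ≈ ev q x * ev (mon f) x + ev (toList r) x
  division {n} f []  = [] , replicate n K.0# , λ x →
    sym (trans (+-cong (zeroˡ _) (ev-zero (toList (replicate n K.0#)) (zeros n) x)) (+-identityˡ _))
    where
    zeros : ∀ n i → coeff (toList (replicate n K.0#)) i K.≈ K.0#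
    zeros zero    i       = K.refl
    zeros (suc n) zero    = K.refl
    zeros (suc n) (suc i) = zeros n i
  division f (a ∷ p) with division f p
  ... | q , r , p≈ with reduce a f r
    where
    -- `c` is the coefficient of the n-th power of x in `a + x r`. If `f` is empty, the divisor is 1
    -- and `c` is `a` itself.
    reduce : ∀ {n} a (f r : Vec K.Carrier n) → ∃[ c ] Σ[ s ∈ Vec K.Carrier n ]
             ∀ x → ι a + x * ev (toList r) x ≈ ι c * ev (mon f) x + ev (toList s) x
    reduce a []      []      = a , [] , λ x → begin
      ι a + x * 0#          ≈⟨ +-congˡ (zeroʳ x) ⟩
      ι a + 0#              ≈⟨ +-congʳ (*-identityʳ _) ⟨
      ι a * 1# + 0#         ≈⟨ +-congʳ (*-congˡ (ev-1 x)) ⟨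
      ι a * ev [ K.1# ] x + 0#  ∎
    reduce a (b ∷ f) (d ∷ r) with reduce d f r
    ... | c , s , e = c , (a K.- c K.* b) ∷ s , λ x → let M = ev (mon f) x; S = ev (toList s) x in begin
      ι a + x * (ι d + x * ev (toList r) x)           ≈⟨ +-congˡ (*-congˡ (e x)) ⟩
      ι a + x * (ι c * M + S)
        ≈⟨ solve 6 (λ a b c x m s → a :+ x :* (c :* m :+ s) := c :* (b :+ x :* m) :+ ((a :- c :* b) :+ x :* s))
             refl (ι a) (ι b) (ι c) x M S ⟩
      ι c * (ι b + x * M) + ((ι a - ι c * ι b) + x * S) ≈⟨ +-congˡ (+-congʳ (ι-sub-mul a c b)) ⟨
      ι c * (ι b + x * M) + (ι (a K.- c K.* b) + x * S) ∎
      where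
      ι-sub-mul : ∀ a c b → ι (a K.- c K.* b) ≈ ι a - ι c * ι b
      ι-sub-mul a c b = trans (ι.+-homo _ _) (+-congˡ (trans (ι.-‿homo _) (-‿cong (ι.*-homo c b))))
  ...   | c , s , e = c ∷ q , s , λ x → let M = ev (mon f) x in begin
    ι a + x * ev p x                                          ≈⟨ +-congˡ (*-congˡ (p≈ x)) ⟩
    ι a + x * (ev q x * M + ev (toList r) x)
      ≈⟨ solve 5 (λ a x q m r → a :+ x :* (q :* m :+ r) := (a :+ x :* r) :+ x :* q :* m)
           refl (ι a) x (ev q x) M (ev (toList r) x) ⟩
    (ι a + x * ev (toList r) x) + x * ev q x * M              ≈⟨ +-congʳ (e x) ⟩
    (ι c * M + ev (toList s) x) + x * ev q x * M
      ≈⟨ solve 5 (λ c x q m s → (c :* m :+ s) :+ x :* q :* m := (c :+ x :* q) :* m :+ s)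
           refl (ι c) x (ev q x) M (ev (toList s) x) ⟩
    (ι c + x * ev q x) * M + ev (toList s) x                  ∎

  mon-+ : ∀ {n} p → length p ℕ.≤ n → (xs : Vec K.Carrier n) →
          Σ[ ys ∈ Vec K.Carrier n ] ∀ x → ev (mon ys) x ≈ ev p x + ev (mon xs) x
  mon-+ []      _         xs       = xs , λ x → sym (+-identityˡ _)
  mon-+ (a ∷ p) (s≤s len) (b ∷ xs) with mon-+ p len xs
  ... | ys , e = a K.+ b ∷ ys , λ x → let P = ev p x; X = ev (mon xs) x in begin
    ι (a K.+ b) + x * ev (mon ys) x  ≈⟨ +-cong (ι.+-homo a b) (*-congˡ (e x)) ⟩
    (ι a + ι b) + x * (P + X)
      ≈⟨ solve 5 (λ a b x p q → (a :+ b) :+ x :* (p :+ q) := (a :+ x :* p) :+ (b :+ x :* q))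
           refl (ι a) (ι b) x P X ⟩
    (ι a + x * P) + (ι b + x * X)    ∎

  length-mon : ∀ {n} (xs : Vec K.Carrier n) → length (mon xs) ≡ suc n
  length-mon []       = ≡.refl
  length-mon (_ ∷ xs) = ≡.cong suc (length-mon xs)

  mon-* : ∀ {m n} (xs : Vec K.Carrier m) (ys : Vec K.Carrier n) →
          Σ[ zs ∈ Vec K.Carrier (m ℕ.+ n) ] ∀ x → ev (mon zs) x ≈ ev (mon xs) x * ev (mon ys) x
  mon-* []       ys = ys , λ x → trans (sym (*-identityˡ _)) (*-congʳ (sym (ev-1 x)))
  mon-* {suc m} {n} (a ∷ xs) ys with mon-* xs ys
  ... | zs , e with mon-+ (map (a K.*_) (mon ys)) len (K.0# ∷ zs)
    where
    len : length (map (a K.*_) (mon ys)) ℕ.≤ suc (m ℕ.+ n)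
    len = ℕ.≤-trans (ℕ.≤-reflexive (≡.trans (length-map _ (mon ys)) (length-mon ys))) (s≤s (ℕ.m≤n+m n m))
  ...   | ws , e′ = ws , λ x → let X = ev (mon xs) x; Y = ev (mon ys) x in begin
    ev (mon ws) x                                             ≈⟨ e′ x ⟩
    ev (map (a K.*_) (mon ys)) x + ev (mon (K.0# ∷ zs)) x
      ≈⟨ +-cong (ev-scale a (mon ys) x) (trans (ev-shift (mon zs) x) (*-congˡ (e x))) ⟩
    ι a * Y + x * (X * Y)
      ≈⟨ solve 4 (λ a x p q → a :* q :+ x :* (p :* q) := (a :+ x :* p) :* q) refl (ι a) x X Y ⟩
    (ι a + x * X) * Y                                         ∎

  -- If the lengths differed, one of the leading coefficients 1 and `u` would be 0. The factor `u`
  -- is there for constant cofactors; `u = 1` gives `≈ₘ⇒deg≡`.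
  mon-injective-length : ∀ {m n} {u} → ¬ u K.≈ K.0# → (xs : Vec K.Carrier m) (ys : Vec K.Carrier n) →
                         mon xs ≈ₚ map (u K.*_) (mon ys) → m ≡ n
  mon-injective-length u≉0 []       []       _ = ≡.refl
  mon-injective-length u≉0 []       (y ∷ ys) e = contradiction (top ys (e ∘ suc)) u≉0
    where
    top : ∀ {n u} (ys : Vec K.Carrier n) → (∀ i → K.0# K.≈ coeff (map (u K.*_) (mon ys)) i) → u K.≈ K.0#
    top []       e = K.sym (K.trans (e 0) (K.*-identityʳ _))
    top (_ ∷ ys) e = top ys (e ∘ suc)
  mon-injective-length u≉0 (x ∷ xs) []       e = contradiction (top xs (e ∘ suc)) (K.0≉1 ∘ K.sym)
    where
    top : ∀ {n} (xs : Vec K.Carrier n) → (∀ i → coeff (mon xs) i K.≈ K.0#) → K.1# K.≈ K.0#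
    top []       e = e 0
    top (_ ∷ xs) e = top xs (e ∘ suc)
  mon-injective-length u≉0 (x ∷ xs) (y ∷ ys) e = ≡.cong suc (mon-injective-length u≉0 xs ys (e ∘ suc))

  -- Leading coefficients, minimal polynomials and inverses

  module WithExcludedMiddle (em : ∀ {a} → ExcludedMiddle a) where

    *-≈0 : ∀ {x y} → x * y ≈ 0# → x ≈ 0# ⊎ y ≈ 0#
    *-≈0 {x} xy≈0 with em {P = x ≈ 0#}
    ... | yes x≈0 = inj₁ x≈0
    ... | no  x≉0 = inj₂ (≉0-cancel x≉0 xy≈0)

    -- Trailing zeros hide the leading coefficient of a list; excluded middle locates it.
    normalise : ∀ p → (∀ i → coeff p i K.≈ K.0#) ⊎
      (∃[ u ] ¬ u K.≈ K.0# × ∃[ n ] n ℕ.< length p × Σ[ xs ∈ Vec K.Carrier n ] ∀ x → ev p x ≈ ι u * ev (mon xs) x)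
    normalise []      = inj₁ λ _ → K.refl
    normalise (a ∷ p) with normalise p
    ... | inj₂ (u , u≉0 , n , n<l , xs , e) with K.inverse u u≉0
    ...   | w , uw≈1 = inj₂ (u , u≉0 , suc n , s≤s n<l , w K.* a ∷ xs , λ x → let X = ev (mon xs) x in begin
      ι a + x * ev p x                     ≈⟨ +-cong ι-a (*-congˡ (e x)) ⟩
      ι u * ι (w K.* a) + x * (ι u * X)
        ≈⟨ solve 4 (λ u a x p → u :* a :+ x :* (u :* p) := u :* (a :+ x :* p)) refl (ι u) (ι (w K.* a)) x X ⟩
      ι u * (ι (w K.* a) + x * X)          ∎)
      where
      ι-a : ι a ≈ ι u * ι (w K.* a)
      ι-a = trans (ι.⟦⟧-cong (K.trans (K.sym (K.*-identityˡ a))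
        (K.trans (K.*-congʳ (K.sym uw≈1)) (K.*-assoc u w a)))) (ι.*-homo u (w K.* a))
    normalise (a ∷ p) | inj₁ p≈0 with em {P = a K.≈ K.0#}
    ... | yes a≈0 = inj₁ λ { zero → a≈0 ; (suc i) → p≈0 i }
    ... | no  a≉0 = inj₂ (a , a≉0 , 0 , s≤s z≤n , [] , λ x → begin
      ι a + x * ev p x       ≈⟨ +-congˡ (trans (*-congˡ (ev-zero p p≈0 x)) (zeroʳ x)) ⟩
      ι a + 0#               ≈⟨ +-identityʳ _ ⟩
      ι a                    ≈⟨ *-identityʳ _ ⟨
      ι a * 1#               ≈⟨ *-congˡ (ev-1 x) ⟨
      ι a * ev [ K.1# ] x    ∎)

    minimal-polynomial : ∀ x → ∃[ f ] IsMinimalPolynomial x f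
    minimal-polynomial x = <-rec P step _ (proj₁ (algebraic x)) (proj₂ (algebraic x)) ≡.refl
      where
      P : ℕ → Set _
      P n = ∀ f → f ⟨ x ⟩ ≈ 0# → deg f ≡ n → ∃[ f ] IsMinimalPolynomial x f

      step : ∀ n → (∀ {m} → m ℕ.< n → P m) → P n
      step n rec f fx≈0 ≡.refl with em {P = ∃[ g ] g ⟨ x ⟩ ≈ 0# × deg g ℕ.< deg f}
      ... | yes (g , gx≈0 , lt) = rec lt g gx≈0 ≡.refl
      ... | no  none = f , fx≈0 , λ g gx≈0 → ℕ.≮⇒≥ λ lt → none (g , gx≈0 , lt)

    mon-minimal-≉0 : ∀ {x} f → IsMinimalPolynomial x f → ∀ {n} (xs : Vec K.Carrier n) →
                     n ℕ.< deg f → ¬ ev (mon xs) x ≈ 0#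
    mon-minimal-≉0 f _             []       _   e = 0≉1 (trans (sym e) (ev-1 _))
    mon-minimal-≉0 f (_ , minimal) {suc n} xs n<d e = ℕ.<⇒≱ n<d (minimal (monic n xs) e)

    minimal-remainder : ∀ {x} f → IsMinimalPolynomial x f → ∀ (r : Vec K.Carrier (deg f)) →
                        ev (toList r) x ≈ 0# → ∀ y → ev (toList r) y ≈ 0#
    minimal-remainder {x} f f-min r rx≈0 y = helper (normalise (toList r))
      where
      helper : _ → ev (toList r) y ≈ 0#
      helper (inj₁ r≈0) = ev-zero (toList r) r≈0 y
      helper (inj₂ (u , u≉0 , n , n<l , xs , e)) = contradiction
        (≉0-cancel (ι-≉0 u≉0) (trans (sym (e x)) rx≈0))
        (mon-minimal-≉0 f f-min xs (≡.subst (n ℕ.<_) (length-toList r) n<l))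

    minimal-divides : ∀ {x} f → IsMinimalPolynomial x f → ∀ p → ev p x ≈ 0# →
                      ∃[ q ] ∀ y → ev p y ≈ ev q y * f ⟨ y ⟩
    minimal-divides {x} f f-min@(fx≈0 , _) p px≈0 with division (lower f) p
    ... | q , r , e = q , λ y → trans (e y) (trans (+-congˡ (minimal-remainder f f-min r rx≈0 y)) (+-identityʳ _))
      where
      rx≈0 : ev (toList r) x ≈ 0#
      rx≈0 = begin
        ev (toList r) x                       ≈⟨ +-identityˡ _ ⟨
        0# + ev (toList r) x                  ≈⟨ +-congʳ (trans (*-congˡ fx≈0) (zeroʳ _)) ⟨
        ev q x * f ⟨ x ⟩ + ev (toList r) x    ≈⟨ e x ⟨
        ev p x                                ≈⟨ px≈0 ⟩
        0#                                    ∎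

    minimal-vanishes : ∀ {x y} f → IsMinimalPolynomial x f → f ⟨ y ⟩ ≈ 0# → ∀ p → ev p x ≈ 0# → ev p y ≈ 0#
    minimal-vanishes f f-min fy≈0 p px≈0 with minimal-divides f f-min p px≈0
    ... | q , e = trans (e _) (trans (*-congˡ fy≈0) (zeroʳ _))

    -- Read off from the minimal polynomial c + x k(x) of x, as c ≠ 0.
    polynomial-inverse : ∀ x → ¬ x ≈ 0# → ∃[ k ] x * ev k x ≈ 1#
    polynomial-inverse x x≉0 with minimal-polynomial x
    ... | f@(monic d (c ∷ xs)) , f-min@(fx≈0 , _) with em {P = c K.≈ K.0#}
    ...   | yes c≈0 = contradiction (≉0-cancel x≉0 (begin
        x * ev (mon xs) x            ≈⟨ +-identityˡ _ ⟨
        0# + x * ev (mon xs) x       ≈⟨ +-congʳ (trans (ι.⟦⟧-cong c≈0) ι.0#-homo) ⟨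
        ι c + x * ev (mon xs) x      ≈⟨ fx≈0 ⟩
        0#                           ∎)) (mon-minimal-≉0 f f-min xs ℕ.≤-refl)
    ...   | no  c≉0 with K.inverse c c≉0
    ...     | w , cw≈1 = map (K.- w K.*_) (mon xs) , (begin
      x * ev (map (K.- w K.*_) (mon xs)) x
        ≈⟨ *-congˡ (trans (ev-scale (K.- w) (mon xs) x) (*-congʳ (ι.-‿homo w))) ⟩
      x * (- ι w * X)
        ≈⟨ solve 4 (λ x w c m → x :* (:- w :* m) := c :* w :- w :* (c :+ x :* m)) refl x (ι w) (ι c) X ⟩
      ι c * ι w - ι w * (ι c + x * X)
        ≈⟨ +-cong (trans (sym (ι.*-homo c w)) (ι.⟦⟧-cong cw≈1)) (-‿cong (trans (*-congˡ fx≈0) (zeroʳ _))) ⟩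
      ι K.1# - 0#                                ≈⟨ +-cong ι.1#-homo -0#≈0# ⟩
      1# + 0#                                    ≈⟨ +-identityʳ _ ⟩
      1#                                         ∎)
      where X = ev (mon xs) x

-- Minimal polynomials

module MinimalPolynomialTheory {c ℓ} (em : ∀ {a} → ExcludedMiddle a) (K : Field c ℓ)
    (E : AlgebraicExtension K) (closed : AlgebraicallyClosed (AlgebraicExtension.overfield E)) where
  private module K = Field K
  open PolynomialFunctions K E public
  open WithExcludedMiddle em public
  private module L = Polynomial commutativeRing
  open IntegerCoefficientSolver commutativeRing using (solve; _:=_; _:+_; _:*_; _:-_; :-_)
  open import Algebra.Properties.Ring ring using (x∙y⁻¹≈ε⇒x≈y)
  open import Algebra.Properties.Ring K.ring using () renaming (x∙y⁻¹≈ε⇒x≈y to K-x-y≈0⇒x≈y)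
  open import Relation.Binary.Reasoning.Setoid setoid

  eval-ι : ∀ {n} (xs : Vec K.Carrier n) x → ev (mon xs) x ≈ L.eval (toList (Vec.map ι xs) ++ [ 1# ]) x
  eval-ι []       x = +-congʳ ι.1#-homo
  eval-ι (a ∷ xs) x = +-congˡ (*-congˡ (eval-ι xs x))

  mon-root : ∀ {n} (xs : Vec K.Carrier (suc n)) → ∃[ x ] ev (mon xs) x ≈ 0#
  mon-root {n} xs with closed (L.monic n (Vec.map ι xs))
  ... | x , e = x , trans (eval-ι xs x) e

  -- If the polynomial vanished everywhere, then adding 1 to its constant term would give a
  -- nonconstant polynomial with constant value 1, hence without a root. No count of the elements of
  -- the field is needed.
  mon-nonvanishing : ∀ {n} (xs : Vec K.Carrier n) → ¬ (∀ x → ev (mon xs) x ≈ 0#)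
  mon-nonvanishing []       e = 0≉1 (trans (sym (e 0#)) (ev-1 0#))
  mon-nonvanishing (a ∷ xs) e with mon-root (a K.+ K.1# ∷ xs)
  ... | x , root = 0≉1 (begin
    0#                              ≈⟨ root ⟨
    ι (a K.+ K.1#) + M              ≈⟨ +-congʳ (trans (ι.+-homo a K.1#) (+-congˡ ι.1#-homo)) ⟩
    (ι a + 1#) + M                  ≈⟨ solve 3 (λ a o m → (a :+ o) :+ m := (a :+ m) :+ o) refl (ι a) 1# M ⟩
    (ι a + M) + 1#                  ≈⟨ +-congʳ (e x) ⟩
    0# + 1#                         ≈⟨ +-identityˡ 1# ⟩
    1#                              ∎)
    where M = x * ev (mon xs) x

  ev-injective : ∀ p q → (∀ x → ev p x ≈ ev q x) → p ≈ₚ q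
  ev-injective p q e with normalise (p +ₚ -ₚ q)
  ... | inj₁ r≈0 = λ i → K-x-y≈0⇒x≈y _ _ (K.trans (K.sym (coeff-sub p q i)) (r≈0 i))
  ... | inj₂ (u , u≉0 , _ , _ , xs , e′) = contradiction
    (λ x → ≉0-cancel (ι-≉0 u≉0) (begin
      ι u * ev (mon xs) x    ≈⟨ e′ x ⟨
      ev (p +ₚ -ₚ q) x       ≈⟨ ev-sub p q x ⟩
      ev p x - ev q x        ≈⟨ +-congʳ (e x) ⟩
      ev q x - ev q x        ≈⟨ -‿inverseʳ _ ⟩
      0#                     ∎))
    (mon-nonvanishing xs)

  -- At a single point the monic factor may vanish, so the cancellation is done for all points at
  -- once: otherwise the product would be a unit times a monic polynomial, which has a nonzero
  -- value.
  mon-≉0-cancel : ∀ {n} (xs : Vec K.Carrier n) p → (∀ x → ev (mon xs) x * ev p x ≈ 0#) → ∀ x → ev p x ≈ 0#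
  mon-≉0-cancel xs p e with normalise p
  ... | inj₁ p≈0 = ev-zero p p≈0
  ... | inj₂ (u , u≉0 , _ , _ , ys , e′) with mon-* xs ys
  ...   | zs , e″ = contradiction
    (λ x → ≉0-cancel (ι-≉0 u≉0) (let X = ev (mon xs) x; Y = ev (mon ys) x in begin
      ι u * ev (mon zs) x   ≈⟨ *-congˡ (e″ x) ⟩
      ι u * (X * Y)         ≈⟨ solve 3 (λ u x y → u :* (x :* y) := x :* (u :* y)) refl (ι u) X Y ⟩
      X * (ι u * Y)         ≈⟨ *-congˡ (e′ x) ⟨
      X * ev p x            ≈⟨ e x ⟩
      0#                    ∎))
    (mon-nonvanishing zs)

  coeff-scale : ∀ u p i → coeff (map (u K.*_) p) i K.≈ u K.* coeff p i
  coeff-scale u []      i       = K.sym (K.zeroʳ u)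
  coeff-scale u (a ∷ p) zero    = K.refl
  coeff-scale u (a ∷ p) (suc i) = coeff-scale u p i

  ≈ₘ⇒deg≡ : ∀ {f g} → f ≈ₘ g → deg f ≡ deg g
  ≈ₘ⇒deg≡ {f} {g} f≈g = mon-injective-length (K.0≉1 ∘ K.sym) (lower f) (lower g) λ i →
    K.trans (f≈g i) (K.sym (K.trans (coeff-scale K.1# (toPoly g) i) (K.*-identityˡ _)))

  ≈ₘ-sym : ∀ {f g} → f ≈ₘ g → g ≈ₘ f
  ≈ₘ-sym f≈g i = K.sym (f≈g i)

  ≈ₘ-eval : ∀ {f g} → f ≈ₘ g → ∀ x → f ⟨ x ⟩ ≈ g ⟨ x ⟩
  ≈ₘ-eval {f} {g} = ev-cong (toPoly f) (toPoly g)

  minimal-resp-≈ₘ : ∀ {x f g} → f ≈ₘ g → IsMinimalPolynomial x f → IsMinimalPolynomial x g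
  minimal-resp-≈ₘ {x} {f} {g} f≈g (fx≈0 , minimal) =
    trans (sym (≈ₘ-eval {f} {g} f≈g x)) fx≈0 ,
    λ h hx≈0 → ≡.subst (ℕ._≤ deg h) (≈ₘ⇒deg≡ {f} {g} f≈g) (minimal h hx≈0)

  minimal-resp-≈ : ∀ {x y} f → x ≈ y → IsMinimalPolynomial x f → IsMinimalPolynomial y f
  minimal-resp-≈ f x≈y (fx≈0 , minimal) =
    trans (ev-respʳ (toPoly f) (sym x≈y)) fx≈0 ,
    λ h hy≈0 → minimal h (trans (ev-respʳ (toPoly h) x≈y) hy≈0)

  minimal-deg : ∀ {x} f g → IsMinimalPolynomial x f → IsMinimalPolynomial x g → deg f ≡ deg g
  minimal-deg f g (fx≈0 , f-min) (gx≈0 , g-min) = ℕ.≤-antisym (f-min g gx≈0) (g-min f fx≈0)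

  minimal-unique : ∀ {x} f g → IsMinimalPolynomial x f → IsMinimalPolynomial x g → f ≈ₘ g
  minimal-unique f g f-min g-min with minimal-deg f g f-min g-min
  minimal-unique {x} (monic d xs) (monic .d ys) f-min g-min | ≡.refl =
    ev-injective (mon xs) (mon ys) λ y → x∙y⁻¹≈ε⇒x≈y _ _ (trans (sym (difference xs ys y))
      (minimal-remainder (monic d xs) f-min (Vec.zipWith K._-_ xs ys)
        (trans (difference xs ys x) (trans (+-cong (proj₁ f-min) (-‿cong (proj₁ g-min))) (-‿inverseʳ 0#))) y))
    where
    difference : ∀ {n} (xs ys : Vec K.Carrier n) y →
                 ev (toList (Vec.zipWith K._-_ xs ys)) y ≈ ev (mon xs) y - ev (mon ys) y
    difference []       []       y = sym (-‿inverseʳ _)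
    difference (a ∷ xs) (b ∷ ys) y = begin
      ι (a K.- b) + y * ev (toList (Vec.zipWith K._-_ xs ys)) y
        ≈⟨ +-cong (trans (ι.+-homo a _) (+-congˡ (ι.-‿homo b))) (*-congˡ (difference xs ys y)) ⟩
      (ι a - ι b) + y * (ev (mon xs) y - ev (mon ys) y)
        ≈⟨ solve 5 (λ a b y p q → (a :- b) :+ y :* (p :- q) := (a :+ y :* p) :- (b :+ y :* q)) refl
             (ι a) (ι b) y (ev (mon xs) y) (ev (mon ys) y) ⟩
      (ι a + y * ev (mon xs) y) - (ι b + y * ev (mon ys) y)  ∎

  open RawSemiringDefs polyRawSemiring using (_∣_; mkIrred)

  -- As `p` vanishes at `α`, it is a multiple `s f`. Then `f = s f q`, that is `f (1 - s q) = 0`,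
  -- and the monic `f` cancels.
  root-factor⇒unit : ∀ {α} f → IsMinimalPolynomial α f → ∀ p q → (∀ x → f ⟨ x ⟩ ≈ ev p x * ev q x) →
                     ev p α ≈ 0# → q ∣ [ K.1# ]
  root-factor⇒unit f f-min p q f≈pq pα≈0 with minimal-divides f f-min p pα≈0
  ... | s , p≈sf = s , ev-injective (s *ₚ q) [ K.1# ] λ x → sym (x∙y⁻¹≈ε⇒x≈y _ _ (begin
      ev [ K.1# ] x - ev (s *ₚ q) x       ≈⟨ ev-sub [ K.1# ] (s *ₚ q) x ⟨
      ev ([ K.1# ] +ₚ -ₚ (s *ₚ q)) x      ≈⟨ mon-≉0-cancel (lower f) ([ K.1# ] +ₚ -ₚ (s *ₚ q)) vanish x ⟩
      0#                                  ∎))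
    where
    vanish : ∀ x → f ⟨ x ⟩ * ev ([ K.1# ] +ₚ -ₚ (s *ₚ q)) x ≈ 0#
    vanish x = let F = f ⟨ x ⟩; S = ev s x; Q = ev q x in begin
      F * ev ([ K.1# ] +ₚ -ₚ (s *ₚ q)) x
        ≈⟨ *-congˡ (trans (ev-sub [ K.1# ] (s *ₚ q) x) (+-cong (ev-1 x) (-‿cong (ev-* s q x)))) ⟩
      F * (1# - S * Q)
        ≈⟨ solve 4 (λ f o s q → f :* (o :- s :* q) := f :* o :- s :* f :* q) refl F 1# S Q ⟩
      F * 1# - S * F * Q                   ≈⟨ +-cong (*-identityʳ F) (-‿cong (*-congʳ (sym (p≈sf x)))) ⟩
      F - ev p x * Q                       ≈⟨ +-congˡ (-‿cong (sym (f≈pq x))) ⟩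
      F - F                                ≈⟨ -‿inverseʳ F ⟩
      0#                                   ∎

  minimal⇒Irr : ∀ {α} f → IsMinimalPolynomial α f → Irr f
  minimal⇒Irr {α} f f-min@(fα≈0 , _) = mkIrred nonunit split
    where
    nonunit : ¬ toPoly f ∣ [ K.1# ]
    nonunit (q , e) = 0≉1 (begin
      0#                    ≈⟨ trans (*-congˡ fα≈0) (zeroʳ _) ⟨
      ev q α * f ⟨ α ⟩      ≈⟨ ev-* q (toPoly f) α ⟨
      ev (q *ₚ toPoly f) α  ≈⟨ ev-cong (q *ₚ toPoly f) [ K.1# ] e α ⟩
      ev [ K.1# ] α         ≈⟨ ev-1 α ⟩
      1#                    ∎)

    split : ∀ {p q} → toPoly f ≈ₚ p *ₚ q → p ∣ [ K.1# ] ⊎ q ∣ [ K.1# ]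
    split {p} {q} f≈pq = helper (*-≈0 (trans (sym (f≈ev α)) fα≈0))
      where
      f≈ev : ∀ x → f ⟨ x ⟩ ≈ ev p x * ev q x
      f≈ev x = trans (ev-cong (toPoly f) (p *ₚ q) f≈pq x) (ev-* p q x)

      helper : ev p α ≈ 0# ⊎ ev q α ≈ 0# → _
      helper (inj₁ pα≈0) = inj₂ (root-factor⇒unit f f-min p q f≈ev pα≈0)
      helper (inj₂ qα≈0) = inj₁ (root-factor⇒unit f f-min q p (λ x → trans (f≈ev x) (*-comm _ _)) qα≈0)

  -- A divisor of 1 has no root, so over an algebraically closed field its normal form has degree 0
  -- and `q` is a constant.
  unit-cofactor⇒deg≡ : ∀ f g q → (∀ x → g ⟨ x ⟩ ≈ ev q x * f ⟨ x ⟩) → q ∣ [ K.1# ] → deg g ≡ deg f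
  unit-cofactor⇒deg≡ f g q g≈qf (s , sq≈1) = helper (normalise q)
    where
    sq : ∀ x → ev s x * ev q x ≈ 1#
    sq x = trans (sym (ev-* s q x)) (trans (ev-cong (s *ₚ q) [ K.1# ] sq≈1 x) (ev-1 x))

    q-root : ∀ x → ¬ ev q x ≈ 0#
    q-root x qx≈0 = 0≉1 (trans (sym (trans (*-congˡ qx≈0) (zeroʳ _))) (sq x))

    helper : _ → deg g ≡ deg f
    helper (inj₁ q≈0) = contradiction (ev-zero q q≈0 0#) (q-root 0#)
    helper (inj₂ (u , _ , suc n , _ , xs , q≈)) with mon-root xs
    ... | x , root = contradiction (trans (q≈ x) (trans (*-congˡ root) (zeroʳ _))) (q-root x)
    helper (inj₂ (u , u≉0 , zero , _ , [] , q≈)) =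
      mon-injective-length u≉0 (lower g) (lower f) (ev-injective (toPoly g) (map (u K.*_) (toPoly f)) λ x → begin
        g ⟨ x ⟩                          ≈⟨ g≈qf x ⟩
        ev q x * f ⟨ x ⟩                 ≈⟨ *-congʳ (q≈ x) ⟩
        ι u * ev [ K.1# ] x * f ⟨ x ⟩    ≈⟨ *-congʳ (trans (*-congˡ (ev-1 x)) (*-identityʳ _)) ⟩
        ι u * f ⟨ x ⟩                    ≈⟨ ev-scale u (toPoly f) x ⟨
        ev (map (u K.*_) (toPoly f)) x   ∎)

  -- The minimal polynomial of `α` divides `f` and is not a unit, so irreducibility makes its
  -- cofactor a unit and the degrees agree.
  Irr⇒minimal : ∀ {α} f → Irr f → f ⟨ α ⟩ ≈ 0# → IsMinimalPolynomial α f
  Irr⇒minimal {α} f (mkIrred _ split) fα≈0 with minimal-polynomial α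
  ... | g , g-min@(gα≈0 , minimal) with minimal-divides g g-min (toPoly f) fα≈0
  ...   | q , f≈qg = fα≈0 , λ h hα≈0 → ≡.subst (ℕ._≤ deg h) (≡.sym (deg≡ (split f≈q*g))) (minimal h hα≈0)
    where
    f≈q*g : toPoly f ≈ₚ q *ₚ toPoly g
    f≈q*g = ev-injective (toPoly f) (q *ₚ toPoly g) λ x → trans (f≈qg x) (sym (ev-* q (toPoly g) x))

    deg≡ : q ∣ [ K.1# ] ⊎ toPoly g ∣ [ K.1# ] → deg f ≡ deg g
    deg≡ (inj₁ q∣1)  = unit-cofactor⇒deg≡ g f q f≈qg q∣1
    deg≡ (inj₂ g∣1)  = contradiction g∣1 (RawSemiringDefs.Irreducible.p∤1 (minimal⇒Irr g g-min))

-- Values of conjugate elements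

module ValuationProperties {c ℓ g₁ g₂ g₃} {F : Field c ℓ} {Γ : OrderedAbelianGroup g₁ g₂ g₃}
    (valuation : Valuation F Γ) where
  open Field F
  open Valuation valuation
  open OrderedAbelianGroup Γ using (_≈∞_; _≤∞_; _+∞_) renaming (0# to 0Γ)
  open ExtendedValueGroup Γ renaming (+-congˡ to +∞-congˡ; +-congʳ to +∞-congʳ; +-cong to +∞-cong
    ; +-identityʳ to +∞-identityʳ; +-identityˡ to +∞-identityˡ; +-assoc to +∞-assoc; +-comm to +∞-comm)
  open import Algebra.Properties.Ring ring using (-1*x≈-x; -‿involutive)
  open import Algebra.Properties.AbelianGroup +-abelianGroup using (⁻¹-anti-homo‿-)

  v≈⊤⇒≈0 : ∀ {x} → ⊤⁺ ≤∞ v x → x ≈ 0#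
  v≈⊤⇒≈0 = Equivalence.to v-∞ ∘ ⊤≤⇒≈⊤

  ≈0⇒v≈⊤ : ∀ {x} → x ≈ 0# → ⊤⁺ ≤∞ v x
  ≈0⇒v≈⊤ = ≤-reflexive ∘ ≈-sym ∘ Equivalence.from v-∞

  v-1 : v 1# ≈∞ fin 0Γ
  v-1 = ≤-antisym (cancel (≤-reflexive v1+v1≈v1+0)) (cancel (≤-reflexive (≈-sym v1+v1≈v1+0)))
    where
    cancel = +-cancelˡ-≤ (λ le → 0≉1 (sym (v≈⊤⇒≈0 le)))
    v1+v1≈v1+0 : v 1# +∞ v 1# ≈∞ v 1# +∞ fin 0Γ
    v1+v1≈v1+0 = ≈-trans (≈-sym (v-* 1# 1#)) (≈-trans (v-cong (*-identityˡ 1#)) (≈-sym (+∞-identityʳ _)))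

  -- `2 v(-1) = v(1) = 0`, and the value group is torsion-free.
  v-neg : ∀ x → v (- x) ≈∞ v x
  v-neg x = ≈-trans (v-cong (sym (-1*x≈-x x)))
    (≈-trans (v-* (- 1#) x) (≈-trans (+∞-congʳ v-1≈0) (+∞-identityˡ (v x))))
    where
    v-1≈0 : v (- 1#) ≈∞ fin 0Γ
    v-1≈0 = ·-cancel-≈ 1
      (≈-trans (+∞-congˡ {v (- 1#)} (+∞-identityʳ _))
      (≈-trans (≈-sym (v-* (- 1#) (- 1#)))
      (≈-trans (v-cong (trans (-1*x≈-x (- 1#)) (-‿involutive 1#)))
      (≈-trans v-1
      (≈-sym (≈-trans (+∞-identityˡ _) (+∞-identityˡ _)))))))

  v-sub-comm : ∀ x y → v (x - y) ≈∞ v (y - x)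
  v-sub-comm x y = ≈-trans (v-cong (sym (⁻¹-anti-homo‿- y x))) (v-neg (y - x))

  ≤v-+ : ∀ {c x y} → c ≤∞ v x → c ≤∞ v y → c ≤∞ v (x + y)
  ≤v-+ {x = x} {y} c≤x c≤y with v-+ x y
  ... | inj₁ x≤ = ≤-trans c≤x x≤
  ... | inj₂ y≤ = ≤-trans c≤y y≤

  v-+-≰ : ∀ {x y} → ¬ v y ≤∞ v x → v (x + y) ≈∞ v x
  v-+-≰ {x} {y} y≰x = ≤-antisym upper (≤v-+ ≤-refl (≰⇒≥ y≰x))
    where
    x+y-y≈x : (x + y) + - y ≈ x
    x+y-y≈x = trans (+-assoc x y (- y)) (trans (+-congˡ (-‿inverseʳ y)) (+-identityʳ x))

    upper : v (x + y) ≤∞ v x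
    upper with v-+ (x + y) (- y)
    ... | inj₁ le = ≤-respʳ-≈ (v-cong x+y-y≈x) le
    ... | inj₂ le = contradiction (≤-respˡ-≈ (v-neg y) (≤-respʳ-≈ (v-cong x+y-y≈x) le)) y≰x

module HenselianConjugates {c ℓ g₁ g₂ g₃} (em : ∀ {a} → ExcludedMiddle a)
    {K : Field c ℓ} {Γ : OrderedAbelianGroup g₁ g₂ g₃} {vK : Valuation K Γ}
    (henselian : Henselian vK) (K̄ : ValuedAlgebraicClosure vK) where
  private module K = Field K
  open ValuedAlgebraicClosure K̄ using (extension; algebraicallyClosed; valuation; v; v-cong; v-∞; v-*; v-+; v-extends)
  open MinimalPolynomialTheory em K extension algebraicallyClosed public
  open ValuationProperties valuation public
  open OrderedAbelianGroup Γ using (_≈∞_; _≤∞_; _+∞_) renaming (0# to 0Γ)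
  private module G = ExtendedValueGroup Γ
  open G using (_·∞_; ≈-sym; ≈-trans; ≤-reflexive; ≤-trans; ≤-antisym; ≤-respʳ-≈)
  open RawSemiringDefs polyRawSemiring using (_^_)
  open import Relation.Binary.Reasoning.Setoid setoid
  open import Algebra.Properties.Ring ring using (x∙y⁻¹≈ε⇒x≈y)

  v-ev-^ : ∀ n p x → v (ev (p ^ n) x) ≈∞ n ·∞ v (ev p x)
  v-ev-^ zero    p x = ≈-trans (v-cong (ev-1 x)) v-1
  v-ev-^ (suc n) p x = ≈-trans (v-cong (ev-* p (p ^ n) x))
    (≈-trans (v-* (ev p x) (ev (p ^ n) x)) (G.+-congˡ {v (ev p x)} (v-ev-^ n p x)))

  -- Two distinct terms of the minimal equation of x have the same value.
  v-torsion : ∀ x → ¬ x ≈ 0# → ∃[ n ] ∃[ a ] ¬ a K.≈ K.0# × suc n ·∞ v x ≈∞ v (ι a)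
  v-torsion x x≉0 with minimal-polynomial x
  ... | f , fx≈0 , _ with go (lower f)
    where
    Torsion = ∃[ n ] ∃[ a ] ¬ a K.≈ K.0# × suc n ·∞ v x ≈∞ v (ι a)

    -- The scan starts at the leading term. As long as no two terms tie, the value of the tail is
    -- that of a single term `a xⁱ`, hence finite; at the end this contradicts `f(x) = 0`.
    go : ∀ {n} (xs : Vec K.Carrier n) →
         Torsion ⊎ ∃[ i ] ∃[ a ] ¬ a K.≈ K.0# × v (ev (mon xs) x) ≈∞ v (ι a) +∞ i ·∞ v x
    go []       = inj₂ (0 , K.1# , K.0≉1 ∘ K.sym ,
      ≈-trans (v-cong (ev-const K.1# x)) (≈-sym (G.+-identityʳ (v (ι K.1#)))))
    go (a ∷ xs) with go xs
    ... | inj₁ t = inj₁ t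
    ... | inj₂ (i , b , b≉0 , e) = helper em em em
      where
      M = ev (mon xs) x

      vxM : v (x * M) ≈∞ v (ι b) +∞ suc i ·∞ v x
      vxM = ≈-trans (v-* x M) (≈-trans (G.+-congˡ {v x} e)
        (≈-trans (≈-sym (G.+-assoc (v x) _ _)) (≈-trans (G.+-congʳ (G.+-comm (v x) (v (ι b)))) (G.+-assoc (v (ι b)) _ _))))

      helper : _ → _ → _ → _
      helper (yes a≈0) _ _ = inj₂ (suc i , b , b≉0 , ≈-trans
        (v-cong (trans (+-congʳ (trans (ι.⟦⟧-cong {y = K.0#} a≈0) ι.0#-homo)) (+-identityˡ _))) vxM)
      helper (no a≉0) (no xM≰a) _ = inj₂ (0 , a , a≉0 ,
        ≈-trans (v-+-≰ {y = x * M} xM≰a) (≈-sym (G.+-identityʳ (v (ι a)))))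
      helper (no a≉0) (yes xM≤a) (no a≰xM) = inj₂ (suc i , b , b≉0 ,
        ≈-trans (v-cong (+-comm (ι a) (x * M))) (≈-trans (v-+-≰ {y = ι a} a≰xM) vxM))
      -- The tie `v(a) = v(b) + (i + 1) v(x)` exhibits `(i + 1) v(x)` as the value of `a / b`.
      helper (no a≉0) (yes xM≤a) (yes a≤xM) with K.inverse b b≉0
      ... | d , bd≈1 = inj₁ (i , a K.* d , ad≉0 , ≈-sym
          (≈-trans (v-cong (ι.*-homo a d)) (≈-trans (v-* (ι a) (ι d))
            (G.+-cancel-inverse (≈-trans (≤-antisym a≤xM xM≤a) vxM)
              (≈-trans (≈-sym (v-* (ι b) (ι d))) (≈-trans (v-cong bd) v-1))))))
        where
        bd : ι b * ι d ≈ 1#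
        bd = trans (sym (ι.*-homo b d)) (trans (ι.⟦⟧-cong bd≈1) ι.1#-homo)

        ad≉0 : ¬ a K.* d K.≈ K.0#
        ad≉0 ad≈0 = a≉0 (K.trans (K.sym (K.*-identityʳ a)) (K.trans (K.*-congˡ (K.sym bd≈1))
          (K.trans (K.*-congˡ (K.*-comm b d)) (K.trans (K.sym (K.*-assoc a d b))
          (K.trans (K.*-congʳ ad≈0) (K.zeroˡ b))))))
  ...   | inj₁ t = t
  ...   | inj₂ (i , a , a≉0 , e) = contradiction
    (≤-trans (≈0⇒v≈⊤ fx≈0) (≤-reflexive e))
    (G.+-finite (λ le → ι-≉0 a≉0 (v≈⊤⇒≈0 le)) (G.·-finite i (λ le → x≉0 (v≈⊤⇒≈0 le))))

  compose : Poly → Poly → Poly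
  compose []      q = []
  compose (a ∷ p) q = [ a ] +ₚ q *ₚ compose p q

  ev-compose : ∀ p q x → ev (compose p q) x ≈ ev p (ev q x)
  ev-compose []      q x = refl
  ev-compose (a ∷ p) q x = begin
    ev ([ a ] +ₚ q *ₚ compose p q) x          ≈⟨ ev-+ [ a ] (q *ₚ compose p q) x ⟩
    ev [ a ] x + ev (q *ₚ compose p q) x
      ≈⟨ +-cong (ev-const a x) (trans (ev-* q (compose p q) x) (*-congˡ (ev-compose p q x))) ⟩
    ι a + ev q x * ev p (ev q x)              ∎

  -- K(α), with elements represented by polynomials.
  module SimpleExtension (α : Carrier) where

    polyRawRing : RawRing _ _
    polyRawRing = record
      { Carrier = Poly
      ; _≈_     = λ p q → ev p α ≈ ev q α
      ; _+_     = _+ₚ_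
      ; _*_     = _*ₚ_
      ; -_      = -ₚ_
      ; 0#      = []
      ; 1#      = [ K.1# ]
      }

    -- Equality on representatives is equality of values at `α`, so evaluation is injective by
    -- definition and the ring laws are pulled back from `K̄`.
    ev-isRingMonomorphism : IsRingMonomorphism polyRawRing (Field.rawRing overfield) (λ p → ev p α)
    ev-isRingMonomorphism = record
      { isRingHomomorphism = record
        { isSemiringHomomorphism = record
          { isNearSemiringHomomorphism = record
            { +-isMonoidHomomorphism = record
              { isMagmaHomomorphism = record
                { isRelHomomorphism = record { cong = id }
                ; homo = λ p q → ev-+ p q α }
              ; ε-homo = refl }
            ; *-homo = λ p q → ev-* p q α }
          ; 1#-homo = ev-1 α }
        ; -‿homo = λ p → ev-neg p α }
      ; injective = id
      }

    field′ : Field c ℓ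
    field′ = record
      { commutativeRing = record
        { isCommutativeRing = RingMonomorphism.isCommutativeRing ev-isRingMonomorphism
            (Field.isCommutativeRing overfield) }
      ; 0≉1     = λ e → 0≉1 (trans e (ev-1 α))
      -- The inverse of `y = p(α)` is a polynomial `k` in `y`; substituting `p` into `k` makes it a
      -- polynomial in `α`.
      ; inverse = λ p p≉0 → let (k , e) = polynomial-inverse (ev p α) p≉0 in
          compose k p , trans (ev-* p (compose k p) α)
            (trans (*-congˡ (ev-compose k p α)) (trans e (sym (ev-1 α))))
      }

    simpleExtension : AlgebraicExtension K
    simpleExtension = record
      { overfield = field′
      ; ι = [_]
      ; isRingHomomorphism = record
        { isSemiringHomomorphism = record
          { isNearSemiringHomomorphism = record
            { +-isMonoidHomomorphism = record
              { isMagmaHomomorphism = record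
                { isRelHomomorphism = record
                  { cong = λ {a} {b} a≈b → trans (ev-const a α) (trans (ι.⟦⟧-cong a≈b) (sym (ev-const b α))) }
                ; homo = λ a b → refl }
              ; ε-homo = trans (ev-const K.0# α) ι.0#-homo }
            ; *-homo = λ a b → +-congʳ (ι.⟦⟧-cong (K.sym (K.+-identityʳ _))) }
          ; 1#-homo = refl }
        ; -‿homo = λ a → refl }
      ; algebraic = λ p → let (f , e) = algebraic (ev p α) in f , trans (ev-eval (toPoly f) p) e
      }
      where
      ev-eval : ∀ g p → ev (Polynomial.eval (Field.commutativeRing field′) (map [_] g) p) α ≈ ev g (ev p α)
      ev-eval []      p = refl
      ev-eval (a ∷ g) p = let q = Polynomial.eval (Field.commutativeRing field′) (map [_] g) p in begin
        ev ([ a ] +ₚ p *ₚ q) α          ≈⟨ ev-+ [ a ] (p *ₚ q) α ⟩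
        ev [ a ] α + ev (p *ₚ q) α
          ≈⟨ +-cong (ev-const a α) (trans (ev-* p q α) (*-congˡ (ev-eval g p))) ⟩
        ι a + ev p α * ev g (ev p α)    ∎

    module _ (β : Carrier) (vanish : ∀ p → ev p α ≈ 0# ⇔ ev p β ≈ 0#) where

      vanish-≈ : ∀ p q → ev p α ≈ ev q α → ev p β ≈ ev q β
      vanish-≈ p q e = x∙y⁻¹≈ε⇒x≈y _ _ (trans (sym (ev-sub p q β))
        (Equivalence.to (vanish (p +ₚ -ₚ q)) (trans (ev-sub p q α) (trans (+-congʳ e) (-‿inverseʳ _)))))

      -- The embedding is `p(α) ↦ p(β)`; the two directions of `vanish` make it well defined and
      -- injective.
      pullback : Valuation field′ Γ
      pullback = record
        { v      = λ p → v (ev p β)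
        ; v-cong = λ {p} {q} e → v-cong (vanish-≈ p q e)
        ; v-∞    = λ {p} → mk⇔ (λ e → Equivalence.from (vanish p) (Equivalence.to v-∞ e))
                               (λ e → Equivalence.from v-∞ (Equivalence.to (vanish p) e))
        ; v-*    = λ p q → ≈-trans (v-cong (ev-* p q β)) (v-* (ev p β) (ev q β))
        ; v-+    = λ p q → Sum.map (λ le → ≤-respʳ-≈ (v-cong (sym (ev-+ p q β))) le)
                                   (λ le → ≤-respʳ-≈ (v-cong (sym (ev-+ p q β))) le)
                                   (v-+ (ev p β) (ev q β))
        }

      pullback-extends : ∀ a → Valuation.Integral pullback [ a ] ⇔ Valuation.Integral vK a
      pullback-extends a = mk⇔ (≤-respʳ-≈ e) (≤-respʳ-≈ (≈-sym e))
        where e = ≈-trans (v-cong (ev-const a β)) (v-extends a)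

  module _ {α β} (f : Monic) (f-min : IsMinimalPolynomial α f) (fβ≈0 : f ⟨ β ⟩ ≈ 0#) where
    open SimpleExtension α

    -- For the converse, if `p(α) ≠ 0` then a relation `p q = 1` at `α` persists at `β` and excludes
    -- `p(β) = 0`.
    vanish-⇔ : ∀ p → ev p α ≈ 0# ⇔ ev p β ≈ 0#
    vanish-⇔ p = mk⇔ (minimal-vanishes f f-min fβ≈0 p) back
      where
      back : ev p β ≈ 0# → ev p α ≈ 0#
      back pβ≈0 with em {P = ev p α ≈ 0#}
      ... | yes pα≈0 = pα≈0
      ... | no  pα≉0 with Field.inverse field′ p pα≉0
      ...   | q , pq≈1 = contradiction (begin
        0#                        ≈⟨ trans (*-congʳ pβ≈0) (zeroˡ _) ⟨
        ev p β * ev q β           ≈⟨ ev-* p q β ⟨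
        ev (p *ₚ q) β
          ≈⟨ x∙y⁻¹≈ε⇒x≈y _ _ (trans (sym (ev-sub (p *ₚ q) [ K.1# ] β)) (minimal-vanishes f f-min fβ≈0 (p *ₚ q +ₚ -ₚ [ K.1# ])
               (trans (ev-sub (p *ₚ q) [ K.1# ] α) (trans (+-congʳ pq≈1) (-‿inverseʳ _))))) ⟩
        ev [ K.1# ] β             ≈⟨ ev-1 β ⟩
        1#                        ∎) 0≉1

    integral-⇔ : ∀ p → fin 0Γ ≤∞ v (ev p α) ⇔ fin 0Γ ≤∞ v (ev p β)
    integral-⇔ = henselian simpleExtension Γ Γ (pullback α id-⇔) (pullback β vanish-⇔)
      (pullback-extends α id-⇔) (pullback-extends β vanish-⇔)
      where id-⇔ = λ p → mk⇔ id id

    -- Both `p` and its inverse `q` are integral at `α`, hence at `β`, where their values still add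
    -- up to 0.
    unit-conjugate : ∀ p → v (ev p α) ≈∞ fin 0Γ → v (ev p β) ≈∞ fin 0Γ
    unit-conjugate p vp≈0 with Field.inverse field′ p (λ pα≈0 →
      contradiction (≤-trans (≈0⇒v≈⊤ pα≈0) (≤-reflexive vp≈0)) λ ())
    ... | q , pq≈1 = ≤-antisym
        (≤-trans (≤-reflexive (≈-sym (G.+-identityʳ _))) (≤-trans (G.+-monoˡ-≤ (v (ev p β)) 0≤vq) (≤-reflexive sum≈0)))
        (Equivalence.to (integral-⇔ p) (≤-reflexive (≈-sym vp≈0)))
      where
      product : ∀ x → ev (p *ₚ q) x ≈ ev [ K.1# ] x → v (ev p x) +∞ v (ev q x) ≈∞ fin 0Γ
      product x e = ≈-trans (≈-sym (v-* (ev p x) (ev q x)))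
        (≈-trans (v-cong (trans (sym (ev-* p q x)) (trans e (ev-1 x)))) v-1)

      sum≈0 = product β (vanish-≈ β vanish-⇔ (p *ₚ q) [ K.1# ] pq≈1)

      0≤vq : fin 0Γ ≤∞ v (ev q β)
      0≤vq = Equivalence.to (integral-⇔ q) (≤-reflexive (≈-sym
        (≈-trans (≈-sym (G.+-identityˡ _)) (≈-trans (G.+-congʳ (≈-sym vp≈0)) (product α pq≈1)))))

    -- By `v-torsion` a multiple of `v(p(α))` is `v(a)` with `a` in `K`. Dividing that power of `p`
    -- by `a` gives a unit at `α`, hence at `β`; the constant and the exponent then cancel.
    v-conjugate : ∀ p → v (ev p α) ≈∞ v (ev p β)
    v-conjugate p = helper em
      where
      helper : _ → _
      helper (yes pα≈0) = v-cong (trans pα≈0 (sym (Equivalence.to (vanish-⇔ p) pα≈0)))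
      helper (no  pα≉0) with v-torsion (ev p α) pα≉0
      ... | n , a , a≉0 , e with K.inverse a a≉0
      ...   | d , ad≈1 = G.·-cancel-≈ n (≤-antisym
          (G.+-cancelˡ-≤ d<⊤ (≤-reflexive same)) (G.+-cancelˡ-≤ d<⊤ (≤-reflexive (≈-sym same))))
        where
        d<⊤ : ¬ ⊤⁺ ≤∞ v (ι d)
        d<⊤ le = 0≉1 (trans (sym (trans (*-congˡ (v≈⊤⇒≈0 le)) (zeroʳ (ι a))))
          (trans (sym (ι.*-homo a d)) (trans (ι.⟦⟧-cong ad≈1) ι.1#-homo)))

        h = [ d ] *ₚ (p ^ suc n)

        v-h : ∀ x → v (ev h x) ≈∞ v (ι d) +∞ suc n ·∞ v (ev p x)
        v-h x = ≈-trans (v-cong (ev-* [ d ] (p ^ suc n) x)) (≈-trans (v-* (ev [ d ] x) (ev (p ^ suc n) x))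
          (G.+-cong (v-cong (ev-const d x)) (v-ev-^ (suc n) p x)))

        vh≈0 : v (ev h α) ≈∞ fin 0Γ
        vh≈0 = ≈-trans (v-h α) (≈-trans (G.+-congˡ {v (ι d)} e) (≈-trans (≈-sym (v-* (ι d) (ι a)))
          (≈-trans (v-cong (trans (*-comm (ι d) (ι a)) (trans (sym (ι.*-homo a d)) (trans (ι.⟦⟧-cong ad≈1) ι.1#-homo)))) v-1)))

        same : v (ι d) +∞ suc n ·∞ v (ev p α) ≈∞ v (ι d) +∞ suc n ·∞ v (ev p β)
        same = ≈-trans (≈-sym (v-h α)) (≈-trans vh≈0 (≈-trans (≈-sym (unit-conjugate h vh≈0)) (v-h β)))

-- Newton polygons

module RootValues {c ℓ g₁ g₂ g₃} {F : Field c ℓ} {Γ : OrderedAbelianGroup g₁ g₂ g₃}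
    (valuation : Valuation F Γ) (closed : AlgebraicallyClosed F) where
  open Field F
  open Polynomial commutativeRing
  open Valuation valuation
  open ValuationProperties valuation
  open OrderedAbelianGroup Γ using (Carrier∞; _≈∞_; _≤∞_; _+∞_)
  private module G = ExtendedValueGroup Γ
  open G using (sum; ≈-refl; ≈-sym; ≈-trans; ≤-reflexive; ≤-trans; ≤-respˡ-≈; ≤-respʳ-≈)
  open IntegerCoefficientSolver commutativeRing using (solve; _:=_; _:+_; _:*_; _:-_; :-_)
  open import Relation.Binary.Reasoning.Setoid setoid

  monicList : ∀ {n} → Vec Carrier n → Poly
  monicList xs = toList xs ++ [ 1# ]

  -- xs = (X - ρ) ys + r as monic polynomials.
  data Quotient (ρ : Carrier) : ∀ {n} → Carrier → Vec Carrier (suc n) → Vec Carrier n → Set (c ⊔ ℓ) where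
    []  : ∀ {r a} → r ≈ a + ρ → Quotient ρ r (a ∷ []) []
    _∷_ : ∀ {n r a b} {xs : Vec Carrier (suc n)} {ys} →
          r ≈ a + ρ * b → Quotient ρ b xs ys → Quotient ρ r (a ∷ xs) (b ∷ ys)

  synthetic : ∀ ρ {n} (xs : Vec Carrier (suc n)) → ∃[ r ] ∃[ ys ] Quotient ρ r xs ys
  synthetic ρ (a ∷ [])          = a + ρ , [] , [] refl
  synthetic ρ (a ∷ xs@(_ ∷ _)) with synthetic ρ xs
  ... | b , ys , q = a + ρ * b , b ∷ ys , refl ∷ q

  eval-Quotient : ∀ {ρ n r} {xs : Vec Carrier (suc n)} {ys} → Quotient ρ r xs ys →
                  ∀ x → eval (monicList xs) x ≈ (x - ρ) * eval (monicList ys) x + r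
  eval-Quotient {ρ} {r = r} ([] {a = a} e) x = begin
    a + x * u
      ≈⟨ solve 4 (λ a x u ρ → a :+ x :* u := (x :- ρ) :* u :+ (a :+ ρ :* u)) refl a x u ρ ⟩
    (x - ρ) * u + (a + ρ * u) ≈⟨ +-congˡ (trans (+-congˡ (trans (*-congˡ u≈1) (*-identityʳ ρ))) (sym e)) ⟩
    (x - ρ) * u + r           ∎
    where
    u = 1# + x * 0#
    u≈1 : u ≈ 1#
    u≈1 = trans (+-congˡ (zeroʳ x)) (+-identityʳ 1#)
  eval-Quotient {ρ} {r = r} (_∷_ {a = a} {b} {xs} {ys} e q) x = let Y = eval (monicList ys) x in begin
    a + x * eval (monicList xs) x             ≈⟨ +-congˡ (*-congˡ (eval-Quotient q x)) ⟩
    a + x * ((x - ρ) * Y + b)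
      ≈⟨ solve 5 (λ a x ρ Y b → a :+ x :* ((x :- ρ) :* Y :+ b) := (x :- ρ) :* (b :+ x :* Y) :+ (a :+ ρ :* b))
           refl a x ρ Y b ⟩
    (x - ρ) * (b + x * Y) + (a + ρ * b)       ≈⟨ +-congˡ e ⟨
    (x - ρ) * (b + x * Y) + r                 ∎

  root-factor : ∀ {n} (xs : Vec Carrier (suc n)) → ∃[ ρ ] ∃[ ys ] ∃[ r ] r ≈ 0# × Quotient ρ r xs ys ×
                (∀ x → eval (monicList xs) x ≈ (x - ρ) * eval (monicList ys) x)
  root-factor {n} xs with closed (monic n xs)
  ... | ρ , root with synthetic ρ xs
  ...   | r , ys , q = ρ , ys , r , r≈0 , q , λ x →
            trans (eval-Quotient q x) (trans (+-congˡ r≈0) (+-identityʳ _))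
    where
    r≈0 : r ≈ 0#
    r≈0 = begin
      r                                        ≈⟨ +-identityˡ r ⟨
      0# + r                                   ≈⟨ +-congʳ (trans (*-congʳ (-‿inverseʳ ρ)) (zeroˡ _)) ⟨
      (ρ - ρ) * eval (monicList ys) ρ + r      ≈⟨ eval-Quotient q ρ ⟨
      eval (monicList xs) ρ                    ≈⟨ root ⟩
      0#                                       ∎

  root-values : ∀ {n} (xs : Vec Carrier n) →
                ∃[ ρ ] ∀ x → v (eval (monicList xs) x) ≈∞ sum {n} (λ i → v (x - ρ i))
  root-values []         = (λ ()) , λ x → ≈-trans (v-cong (trans (+-congˡ (zeroʳ x)) (+-identityʳ 1#))) v-1
  root-values xs@(_ ∷ _) with root-factor xs
  ... | ρ , ys , _ , _ , _ , e with root-values ys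
  ...   | ρs , e′ = ρ Vector.∷ ρs , λ x → ≈-trans (v-cong (e x))
            (≈-trans (v-* (x - ρ) (eval (monicList ys) x)) (G.+-congˡ {v (x - ρ)} (e′ x)))

  -- The k-th coefficient a of the list satisfies v(a) + w + k δ > γ.
  data Above (γ : Carrier∞) : Carrier∞ → Carrier∞ → Poly → Set (c ⊔ g₁ ⊔ g₃) where
    []  : ∀ {w δ} → ¬ ⊤⁺ ≤∞ γ → Above γ w δ []
    _∷_ : ∀ {w δ a p} → ¬ v a +∞ w ≤∞ γ → Above γ (w +∞ δ) δ p → Above γ w δ (a ∷ p)

  -- If δ = v(y), the constant term is the only term of smallest value at y.
  data Dominant (δ : Carrier∞) : Poly → Set (c ⊔ g₁ ⊔ g₃) where
    dominant : ∀ {a p} → Above (v a) δ δ p → Dominant δ (a ∷ p)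

  Above-finite : ∀ {γ w δ p} → Above γ w δ p → ¬ ⊤⁺ ≤∞ γ
  Above-finite ([] γ<⊤)    = γ<⊤
  Above-finite (_ ∷ above) = Above-finite above

  v-+-> : ∀ {x y w γ} → ¬ v x +∞ w ≤∞ γ → ¬ v y +∞ w ≤∞ γ → ¬ v (x + y) +∞ w ≤∞ γ
  v-+-> {x} {y} {w} x>γ y>γ le with v-+ x y
  ... | inj₁ x≤ = x>γ (≤-trans (G.+-monoʳ-≤ w x≤) le)
  ... | inj₂ y≤ = y>γ (≤-trans (G.+-monoʳ-≤ w y≤) le)

  Above-resp-≈ : ∀ {γ γ′ w δ p} → γ ≈∞ γ′ → Above γ w δ p → Above γ′ w δ p
  Above-resp-≈ e ([] γ<⊤)     = [] λ le → γ<⊤ (≤-respʳ-≈ (≈-sym e) le)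
  Above-resp-≈ e (a> ∷ above) = (λ le → a> (≤-respʳ-≈ (≈-sym e) le)) ∷ Above-resp-≈ e above

  -- `s` is the power of `y` split off so far and the offset `w` is its value. Keeping `s` general
  -- lets the induction replace it by `s y`.
  Above-eval : ∀ {γ w y} p s → w ≈∞ v s → Above γ w (v y) p → ¬ v (s * eval p y) ≤∞ γ
  Above-eval []      s _    ([] γ<⊤) le = γ<⊤ (≤-trans (≈0⇒v≈⊤ (zeroʳ s)) le)
  Above-eval {γ} {w} {y} (a ∷ p) s w≈vs (a> ∷ above) le =
    helper (v-+ (a * s) ((s * y) * eval p y))
    where
    expand : a * s + (s * y) * eval p y ≈ s * (a + y * eval p y)
    expand = solve 4 (λ s a y e → a :* s :+ (s :* y) :* e := s :* (a :+ y :* e)) refl s a y (eval p y)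

    sum≤γ : v (a * s + (s * y) * eval p y) ≤∞ γ
    sum≤γ = ≤-respˡ-≈ (v-cong (sym expand)) le

    helper : _ → _
    helper (inj₁ a≤) = a> (≤-respˡ-≈ (≈-trans (v-* a s) (G.+-congˡ {v a} (≈-sym w≈vs))) (≤-trans a≤ sum≤γ))
    helper (inj₂ p≤) = Above-eval p (s * y) (≈-trans (G.+-congʳ w≈vs) (≈-sym (v-* s y))) above (≤-trans p≤ sum≤γ)

  Dominant⇒≉0 : ∀ {y} p → Dominant (v y) p → ¬ eval p y ≈ 0#
  Dominant⇒≉0 {y} (a ∷ p) (dominant dom) e = Above-finite dom
    (≤-trans (≈0⇒v≈⊤ e) (≤-reflexive (v-+-≰ (Above-eval p y ≈-refl dom))))

  private
    remainder-value : ∀ {y a t w γ} → y ≈ a + t → ¬ v y +∞ w ≤∞ γ → ¬ v t +∞ w ≤∞ γ → ¬ v a +∞ w ≤∞ γ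
    remainder-value {y} {a} {t} {w} y≈a+t y> t> le =
      v-+-> {y} { - t} y> (t> ∘ ≤-respˡ-≈ (G.+-congʳ (v-neg t)))
        (≤-respˡ-≈ (G.+-congʳ (v-cong a≈y-t)) le)
      where
      a≈y-t : a ≈ y - t
      a≈y-t = trans (solve 2 (λ a t → a := (a :+ t) :- t) refl a t) (+-congʳ (sym y≈a+t))

  -- Multiplication by `X - ρ` with `v(ρ) < δ` raises the threshold by `v(ρ)`. Each new coefficient
  -- is `y - ρ b` for consecutive old ones: the term `ρ b` gains `v(ρ)`, while `b`, carried to the
  -- next position, gains `δ`, which is more.
  Above-Quotient : ∀ {ρ γ w δ n y} {xs : Vec Carrier (suc n)} {ys} → Quotient ρ y xs ys → ¬ δ ≤∞ v ρ →
                   ¬ v y +∞ w ≤∞ v ρ +∞ γ → Above γ w δ (monicList ys) →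
                   Above (v ρ +∞ γ) w δ (monicList xs)
  -- Here the remaining quotient coefficient is the implicit leading 1.
  Above-Quotient {ρ} {γ} {w} {δ} ([] e) ρ<δ y> (1> ∷ [] γ<⊤) =
    remainder-value e y> ρ> ∷ 1>′ ∷ [] (G.+-finite ρ<⊤ γ<⊤)
    where
    ρ<⊤ : ¬ ⊤⁺ ≤∞ v ρ
    ρ<⊤ le = ρ<δ (≤-trans (G.≤⊤ δ) le)

    ρ> : ¬ v ρ +∞ w ≤∞ v ρ +∞ γ
    ρ> le = 1> (≤-respˡ-≈ (≈-sym (≈-trans (G.+-congʳ v-1) (G.+-identityˡ w))) (G.+-cancelˡ-≤ ρ<⊤ le))

    1>′ : ¬ v 1# +∞ (w +∞ δ) ≤∞ v ρ +∞ γ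
    1>′ le = G.+-mono-≰ 1> (G.≰⇒≥ ρ<δ) ρ<⊤
      (≤-respˡ-≈ (≈-sym (G.+-assoc (v 1#) w δ)) (≤-respʳ-≈ (G.+-comm (v ρ) γ) le))
  Above-Quotient {ρ} {γ} {w} {δ} (_∷_ {b = b} e q) ρ<δ y> (b> ∷ above) =
    remainder-value e y> ρb> ∷ Above-Quotient q ρ<δ b>′ above
    where
    ρ<⊤ : ¬ ⊤⁺ ≤∞ v ρ
    ρ<⊤ le = ρ<δ (≤-trans (G.≤⊤ δ) le)

    ρb> : ¬ v (ρ * b) +∞ w ≤∞ v ρ +∞ γ
    ρb> le = b> (G.+-cancelˡ-≤ ρ<⊤ (≤-respˡ-≈ (≈-trans (G.+-congʳ (v-* ρ b)) (G.+-assoc (v ρ) (v b) w)) le))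

    b>′ : ¬ v b +∞ (w +∞ δ) ≤∞ v ρ +∞ γ
    b>′ le = G.+-mono-≰ b> (G.≰⇒≥ ρ<δ) ρ<⊤
      (≤-respˡ-≈ (≈-sym (G.+-assoc (v b) w δ)) (≤-respʳ-≈ (G.+-comm (v ρ) γ) le))

  -- With remainder 0 the new constant term is `-ρ b`, whose value `v(ρ) + v(b)` is exactly the
  -- raised threshold of `Above-Quotient`.
  Dominant-Quotient : ∀ {ρ δ n r} {xs : Vec Carrier (suc n)} {ys} → Quotient ρ r xs ys → r ≈ 0# →
                      ¬ δ ≤∞ v ρ → Dominant δ (monicList ys) → Dominant δ (monicList xs)
  Dominant-Quotient {ρ} {δ} ([] {a = a} e) r≈0 ρ<δ _ =
    dominant ((λ le → ρ<δ (≤-respˡ-≈ (≈-trans (G.+-congʳ v-1) (G.+-identityˡ δ)) (≤-respʳ-≈ va≈vρ le))) ∷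
    [] λ le → ρ<δ (≤-trans (G.≤⊤ δ) (≤-respʳ-≈ va≈vρ le)))
    where
    va≈vρ : v a ≈∞ v ρ
    va≈vρ = ≈-trans (v-cong (trans (solve 2 (λ a t → a := (a :+ t) :- t) refl a ρ)
      (trans (+-congʳ (trans (sym e) r≈0)) (+-identityˡ _)))) (v-neg ρ)
  Dominant-Quotient {ρ} {δ} (_∷_ {a = a} {b} {xs} e q) r≈0 ρ<δ (dominant dom) =
    dominant (Above-resp-≈ (≈-sym va≈vρ+vb) (Above-Quotient q ρ<δ b> dom))
    where
    va≈vρ+vb : v a ≈∞ v ρ +∞ v b
    va≈vρ+vb = ≈-trans (v-cong (trans (solve 2 (λ a t → a := (a :+ t) :- t) refl a (ρ * b))
      (trans (+-congʳ (trans (sym e) r≈0)) (+-identityˡ _)))) (≈-trans (v-neg (ρ * b)) (v-* ρ b))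

    b> : ¬ v b +∞ δ ≤∞ v ρ +∞ v b
    b> le = ρ<δ (G.+-cancelʳ-≤ (Above-finite dom) (≤-respˡ-≈ (G.+-comm (v b) δ) le))

  -- Dominance passes from 1 to a product of factors `X - ρ` with `v(ρ) < δ`, one factor at a time.
  -- Its contrapositive detects a root of value at least `δ` from the values of the coefficients
  -- alone.
  roots<δ⇒Dominant : ∀ {δ n} (xs : Vec Carrier n) →
                     (∀ x → eval (monicList xs) x ≈ 0# → ¬ δ ≤∞ v x) → Dominant δ (monicList xs)
  roots<δ⇒Dominant []         _ = dominant ([] λ le → contradiction (≤-respʳ-≈ v-1 le) λ ())
  roots<δ⇒Dominant xs@(_ ∷ _) roots<δ with root-factor xs
  ... | ρ , ys , r , r≈0 , q , e = Dominant-Quotient q r≈0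
    (roots<δ ρ (trans (e ρ) (trans (*-congʳ (-‿inverseʳ ρ)) (zeroˡ _))))
    (roots<δ⇒Dominant ys λ x root → roots<δ x (trans (e x) (trans (*-congˡ root) (zeroʳ _))))

-- Taylor expansions at conjugate points

module RootDistances {c ℓ g₁ g₂ g₃} (em : ∀ {a} → ExcludedMiddle a)
    {K : Field c ℓ} {Γ : OrderedAbelianGroup g₁ g₂ g₃} {vK : Valuation K Γ}
    (henselian : Henselian vK) (K̄ : ValuedAlgebraicClosure vK) where
  private module K = Field K
  open ValuedAlgebraicClosure K̄ using (algebraicallyClosed; valuation; v; v-cong)
  open HenselianConjugates em henselian K̄ public
  open RootValues valuation algebraicallyClosed public
  open OrderedAbelianGroup Γ using (_≈∞_; _≤∞_)
  private
    module G = ExtendedValueGroup Γ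
    module L = Polynomial commutativeRing
  open G using (≈-sym; ≤-respˡ-≈; ≤-respʳ-≈)
  open IntegerCoefficientSolver commutativeRing using (solve; _:=_; _:+_; _:*_; _:-_; :-_)
  open import Relation.Binary.Reasoning.Setoid setoid

  -- The coefficients of `p + (X + Y) H` in powers of `Y`, where `H` has the lower coefficients `hs`
  -- and leading coefficient 1: each one is its predecessor plus `X` times itself, and `p` acts as
  -- predecessor of the first.
  mul-X+Y : ∀ {n} → Poly → Vec Poly n → Vec Poly (suc n)
  mul-X+Y p []       = (p +ₚ (K.0# ∷ [ K.1# ])) ∷ []
  mul-X+Y p (h ∷ hs) = (p +ₚ (K.0# ∷ h)) ∷ mul-X+Y h hs

  -- taylor xs lists the coefficients of f(X + Y) in powers of Y, where
  -- f = mon xs.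
  taylor : ∀ {n} → Vec K.Carrier n → Vec Poly n
  taylor []       = []
  taylor (a ∷ xs) = mul-X+Y [ a ] (taylor xs)

  at : ∀ {n} → Carrier → Vec Poly n → L.Poly
  at x hs = monicList (Vec.map (λ h → ev h x) hs)

  eval-mul-X+Y : ∀ {n} p (hs : Vec Poly n) x y →
                 L.eval (at x (mul-X+Y p hs)) y ≈ ev p x + (x + y) * L.eval (at x hs) y
  eval-mul-X+Y p []       x y = begin
    ev (p +ₚ (K.0# ∷ [ K.1# ])) x + y * u
      ≈⟨ +-congʳ (trans (ev-+ p _ x) (+-congˡ (trans (ev-shift [ K.1# ] x) (*-congˡ (ev-1 x))))) ⟩
    (ev p x + x * 1#) + y * u
      ≈⟨ +-congʳ (+-congˡ (*-congˡ (trans (+-congˡ (zeroʳ y)) (+-identityʳ 1#)))) ⟨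
    (ev p x + x * u) + y * u
      ≈⟨ solve 4 (λ p x y u → (p :+ x :* u) :+ y :* u := p :+ (x :+ y) :* u) refl (ev p x) x y u ⟩
    ev p x + (x + y) * u                    ∎
    where u = 1# + y * 0#
  eval-mul-X+Y p (h ∷ hs) x y = let M = L.eval (at x hs) y in begin
    ev (p +ₚ (K.0# ∷ h)) x + y * L.eval (at x (mul-X+Y h hs)) y
      ≈⟨ +-cong (trans (ev-+ p _ x) (+-congˡ (ev-shift h x))) (*-congˡ (eval-mul-X+Y h hs x y)) ⟩
    (ev p x + x * ev h x) + y * (ev h x + (x + y) * M)
      ≈⟨ solve 5 (λ p x h y m → (p :+ x :* h) :+ y :* (h :+ (x :+ y) :* m) := p :+ (x :+ y) :* (h :+ y :* m))
           refl (ev p x) x (ev h x) y M ⟩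
    ev p x + (x + y) * (ev h x + y * M)                           ∎

  eval-taylor : ∀ {n} (xs : Vec K.Carrier n) x y → L.eval (at x (taylor xs)) y ≈ ev (mon xs) (x + y)
  eval-taylor []       x y = trans (+-congˡ (zeroʳ y)) (trans (+-identityʳ 1#) (sym (ev-1 (x + y))))
  eval-taylor (a ∷ xs) x y = trans (eval-mul-X+Y [ a ] (taylor xs) x y)
    (+-cong (ev-const a x) (*-congˡ (eval-taylor xs x y)))

  -- `Dominant` depends on the coefficients only through their values, and each coefficient is a
  -- polynomial over `K` evaluated at `x`.
  Dominant-at : ∀ {x x′} → (∀ h → v (ev h x) ≈∞ v (ev h x′)) → ∀ {δ n} (hs : Vec Poly n) →
                Dominant δ (at x hs) → Dominant δ (at x′ hs)
  Dominant-at {x} {x′} v≈ []       dom = dom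
  Dominant-at {x} {x′} v≈ {δ} (h ∷ hs) (dominant dom) = dominant (Above-resp-≈ (v≈ h) (go hs dom))
    where
    go : ∀ {γ w n} (hs : Vec Poly n) → Above γ w δ (at x hs) → Above γ w δ (at x′ hs)
    go []       (1> ∷ [] γ<⊤) = 1> ∷ [] γ<⊤
    go (h ∷ hs) (h> ∷ above)  = (λ le → h> (≤-respˡ-≈ (G.+-congʳ (≈-sym (v≈ h))) le)) ∷ go hs above

  -- The Newton polygons of g(x + Y) and g(x′ + Y) agree.
  conjugate-distance : ∀ {x x′} → (∀ h → v (ev h x) ≈∞ v (ev h x′)) → ∀ g {β} → g ⟨ β ⟩ ≈ 0# →
                       ∃[ β′ ] g ⟨ β′ ⟩ ≈ 0# × v (β - x′) ≤∞ v (β′ - x)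
  conjugate-distance {x} {x′} v≈ g {β} gβ≈0 with em {P = ∃[ β′ ] g ⟨ β′ ⟩ ≈ 0# × v (β - x′) ≤∞ v (β′ - x)}
  ... | yes near = near
  -- With `δ = v(β - x′)`, every root `y` of `g(x + Y)` would satisfy `v(y) < δ`. The resulting
  -- dominance moves to `x′`, where it forbids the root `β - x′` of `g(x′ + Y)`.
  ... | no  far  = contradiction
    (trans (eval-taylor (lower g) x′ (β - x′))
      (trans (ev-respʳ (toPoly g) (solve 2 (λ x b → x :+ (b :- x) := b) refl x′ β)) gβ≈0))
    (Dominant⇒≉0 (at x′ (taylor (lower g))) (Dominant-at v≈ (taylor (lower g))
      (roots<δ⇒Dominant (Vec.map (λ h → ev h x) (taylor (lower g))) λ y root le →
      far (x + y , trans (sym (eval-taylor (lower g) x y)) root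
          , ≤-respʳ-≈ (v-cong (solve 2 (λ x y → y := (x :+ y) :- x) refl x y)) le))))

-- Weights and distances

module WeightsAndDistances {c ℓ g₁ g₂ g₃} (em : ∀ {a} → ExcludedMiddle a)
    {K : Field c ℓ} {Γ : OrderedAbelianGroup g₁ g₂ g₃} {vK : Valuation K Γ}
    (henselian : Henselian vK) (K̄ : ValuedAlgebraicClosure vK) where
  private module K = Field K
  open ValuedAlgebraicClosure K̄ using (v; v-cong; divisible; _/_)
  open RootDistances em henselian K̄
  private
    module Γ = OrderedAbelianGroup Γ
    module G = ExtendedValueGroup Γ
  open OrderedAbelianGroup Γ using (Carrier∞; _≈∞_; _≤∞_; _<∞_; HasMax)
  open G using (_·∞_; sum; ≈-refl; ≈-sym; ≈-trans; ≈-reflexive; ≤-refl; ≤-reflexive; ≤-trans; ≤-respˡ-≈; ≤-respʳ-≈)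
  open IntegerCoefficientSolver commutativeRing using (solve; _:=_; _:+_; _:-_)
  open import Algebra.Properties.Ring ring using (x∙y⁻¹≈ε⇒x≈y)

  -- The formula for the values already identifies the roots: a sum of values is infinite exactly
  -- when one of its terms is.
  monic-roots : ∀ g → ∃[ ρ ] ((∀ x → v (g ⟨ x ⟩) ≈∞ sum {deg g} (λ i → v (x - ρ i)))
                × (∀ i → g ⟨ ρ i ⟩ ≈ 0#) × (∀ x → g ⟨ x ⟩ ≈ 0# → ∃[ i ] x ≈ ρ i))
  monic-roots g with root-values (Vec.map ι (lower g))
  ... | ρ , e = ρ , values , roots , complete
    where
    values : ∀ x → v (g ⟨ x ⟩) ≈∞ sum (λ i → v (x - ρ i))
    values x = ≈-trans (v-cong (eval-ι (lower g) x)) (e x)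

    roots : ∀ i → g ⟨ ρ i ⟩ ≈ 0#
    roots i = v≈⊤⇒≈0 (≤-respʳ-≈ (≈-sym (values (ρ i)))
      (G.sum-⊤ (λ j → v (ρ i - ρ j)) i (≈0⇒v≈⊤ (-‿inverseʳ (ρ i)))))

    complete : ∀ x → g ⟨ x ⟩ ≈ 0# → ∃[ i ] x ≈ ρ i
    complete x gx≈0 with G.average-≤ {x = ⊤⁺} (λ i → v (x - ρ i))
                           (≤-respʳ-≈ (values x) (≈0⇒v≈⊤ gx≈0))
    ... | i , le = i , x∙y⁻¹≈ε⇒x≈y _ _ (v≈⊤⇒≈0 le)

  ·-/ : ∀ γ n → suc n ·∞ (γ / suc n) ≈∞ γ
  ·-/ ⊤⁺      n = ≈-refl
  ·-/ (fin γ) n = ≈-trans (≈-reflexive (G.·-fin (suc n) _)) (fin-cong (proj₂ (divisible (suc n) γ)))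
    where
    open import Relation.Binary.Construct.Add.Supremum.Equality Γ._≈_ using () renaming ([_] to fin-cong)

  module _ (θ : Carrier) (F : Monic) (F-min : IsMinimalPolynomial θ F) where
    open Okutsu K̄ θ F

    D N : Carrier → Carrier∞
    D β = v (θ - β)
    N β = v (F ⟨ β ⟩)

    D-cong : ∀ {β β′} → β ≈ β′ → D β ≈∞ D β′
    D-cong β≈β′ = v-cong (+-congˡ (-‿cong β≈β′))

    -- Both sides are the value of the resultant of F and g.
    weight-sum : ∀ g → ∃[ β ] (∀ j → g ⟨ β j ⟩ ≈ 0#) ×
                 deg g ·∞ (deg F ·∞ w g) ≈∞ sum {deg g} (λ j → N (β j))
    weight-sum g = β , g-roots , chain
      where
      β = proj₁ (monic-roots g)
      g-values = proj₁ (proj₂ (monic-roots g))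
      g-roots = proj₁ (proj₂ (proj₂ (monic-roots g)))
      ϑ = proj₁ (monic-roots F)
      F-values = proj₁ (proj₂ (monic-roots F))
      F-roots = proj₁ (proj₂ (proj₂ (monic-roots F)))

      open import Relation.Binary.Reasoning.Setoid G.≈-setoid

      chain : deg g ·∞ (deg F ·∞ w g) ≈∞ sum (λ j → N (β j))
      chain = begin
        deg g ·∞ (deg F ·∞ w g)                                 ≈⟨ G.·-assocˡ (w g) (deg g) (deg F) ⟩
        (deg g ℕ.* deg F) ·∞ w g                                ≡⟨ ≡.cong (_·∞ w g) (ℕ.*-comm (deg g) (deg F)) ⟩
        (deg F ℕ.* deg g) ·∞ w g                                ≈⟨ G.·-assocˡ (w g) (deg F) (deg g) ⟨
        deg F ·∞ (deg g ·∞ w g)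
          ≈⟨ G.·-congʳ (deg F) (·-/ (v (g ⟨ θ ⟩)) (degree-1 g)) ⟩
        deg F ·∞ v (g ⟨ θ ⟩)                                    ≈⟨ G.sum-replicate (deg F) ⟨
        sum {deg F} (λ i → v (g ⟨ θ ⟩))
          ≈⟨ G.sum-cong-≋ (λ i → v-conjugate F F-min (F-roots i) (toPoly g)) ⟩
        sum {deg F} (λ i → v (g ⟨ ϑ i ⟩))                       ≈⟨ G.sum-cong-≋ (λ i → g-values (ϑ i)) ⟩
        sum {deg F} (λ i → sum {deg g} (λ j → v (ϑ i - β j)))   ≈⟨ G.∑-comm (λ i j → v (ϑ i - β j)) ⟩
        sum {deg g} (λ j → sum {deg F} (λ i → v (ϑ i - β j)))
          ≈⟨ G.sum-cong-≋ (λ j → G.sum-cong-≋ (λ i → v-sub-comm (ϑ i) (β j))) ⟩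
        sum {deg g} (λ j → sum {deg F} (λ i → v (β j - ϑ i)))   ≈⟨ G.sum-cong-≋ (λ j → F-values (β j)) ⟨
        sum {deg g} (λ j → N (β j))                             ∎

    -- `N` takes the same value at all roots of `φ`, so the sum in `weight-sum` is `deg φ` copies of
    -- `N β`.
    minimal-weight : ∀ {β} φ → IsMinimalPolynomial β φ → deg F ·∞ w φ ≈∞ N β
    minimal-weight φ φ-min = let (_ , roots , e) = weight-sum φ in
      G.·-cancel-≈ (degree-1 φ) (≈-trans e (≈-trans
        (G.sum-cong-≋ (λ j → ≈-sym (v-conjugate φ φ-min (roots j) (toPoly F))))
        (G.sum-replicate (deg φ))))

    N-mono⇒w-mono : ∀ {β β′} φ φ′ → IsMinimalPolynomial β φ → IsMinimalPolynomial β′ φ′ →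
                    N β ≤∞ N β′ → w φ ≤∞ w φ′
    N-mono⇒w-mono φ φ′ φ-min φ′-min le = G.·-cancel-≤ (degree-1 F)
      (≤-respˡ-≈ (≈-sym (minimal-weight φ φ-min)) (≤-respʳ-≈ (≈-sym (minimal-weight φ′ φ′-min)) le))

    w-mono⇒N-mono : ∀ {β β′} φ φ′ → IsMinimalPolynomial β φ → IsMinimalPolynomial β′ φ′ →
                    w φ ≤∞ w φ′ → N β ≤∞ N β′
    w-mono⇒N-mono φ φ′ φ-min φ′-min le =
      ≤-respˡ-≈ (minimal-weight φ φ-min) (≤-respʳ-≈ (minimal-weight φ′ φ′-min) (G.·-mono-≤ (deg F) le))

    record IsNearestConjugate (φ : Monic) (β : Carrier) : Set (c ⊔ ℓ ⊔ g₁ ⊔ g₂ ⊔ g₃) where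
      constructor nearestConjugate
      field
        minimal : IsMinimalPolynomial β φ
        nearest : ∀ {β′} → φ ⟨ β′ ⟩ ≈ 0# → D β′ ≤∞ D β

    minimal-conjugate : ∀ {β β′} φ → IsMinimalPolynomial β φ → φ ⟨ β′ ⟩ ≈ 0# → IsMinimalPolynomial β′ φ
    minimal-conjugate φ φ-min = Irr⇒minimal φ (minimal⇒Irr φ φ-min)

    nearest-conjugate : ∀ {β} φ → IsMinimalPolynomial β φ → ∃ (IsNearestConjugate φ)
    nearest-conjugate φ φ-min =
      let (ρ , _ , roots , complete) = monic-roots φ
          (i , max)                  = G.argmax (D ∘ ρ)
      in ρ i , nearestConjugate (minimal-conjugate φ φ-min (roots i)) λ {β′} root →
        let (j , β′≈ρj) = complete β′ root in ≤-respˡ-≈ (≈-sym (D-cong β′≈ρj)) (max j)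

    module _ {β} φ (β-near : IsNearestConjugate φ β) where
      open IsNearestConjugate β-near

      private
        ϑ        = proj₁ (monic-roots F)
        F-values = proj₁ (proj₂ (monic-roots F))
        F-roots  = proj₁ (proj₂ (proj₂ (monic-roots F)))
        θ-index  = proj₂ (proj₂ (proj₂ (monic-roots F))) θ (proj₁ F-min)

        root-≤-D : ∀ i → v (β - ϑ i) ≤∞ D β
        root-≤-D i =
          let (β′ , root , le) = conjugate-distance (v-conjugate F F-min (F-roots i)) φ (proj₁ minimal)
          in ≤-trans le (≤-respˡ-≈ (v-sub-comm θ β′) (nearest root))

        -- In the telescoped `β′ - ϑ i`, every summand has value at least `v(β - ϑ i)`: nearness of
        -- `β` bounds the latter by `D β`, and `D β ≤ D β′`.
        termwise : ∀ {β′} → D β ≤∞ D β′ → ∀ i → v (β - ϑ i) ≤∞ v (β′ - ϑ i)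
        termwise {β′} le i = ≤-respʳ-≈ (v-cong telescope)
          (≤v-+ (≤v-+ (≤-respʳ-≈ (v-sub-comm θ β′) (≤-trans (root-≤-D i) le)) (root-≤-D i)) ≤-refl)
          where
          telescope : ((β′ - θ) + (θ - β)) + (β - ϑ i) ≈ β′ - ϑ i
          telescope = solve 4 (λ b′ t b s → ((b′ :- t) :+ (t :- b)) :+ (b :- s) := b′ :- s) refl β′ θ β (ϑ i)

      D-mono⇒N-mono : ∀ {β′} → D β ≤∞ D β′ → N β ≤∞ N β′
      D-mono⇒N-mono {β′} le = ≤-respˡ-≈ (≈-sym (F-values β)) (≤-respʳ-≈ (≈-sym (F-values β′))
        (G.sum-mono-≤ (termwise le)))

      -- If `D β < D β′`, then the term at the root `θ` of `F` is strictly larger for `β′`, and all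
      -- terms for `β` are finite, being at most `D β`. Hence `N β < N β′`.
      N-mono⇒D-mono : ∀ {β′} → N β′ ≤∞ N β → D β′ ≤∞ D β
      N-mono⇒D-mono {β′} Nβ′≤Nβ = decidable-stable em λ β<β′ → contradiction
        (≤-respˡ-≈ (F-values β′) (≤-respʳ-≈ (F-values β) Nβ′≤Nβ))
        (G.sum-mono-≰ (termwise (G.≰⇒≥ β<β′))
          (λ i ⊤≤ → β<β′ (≤-trans (G.≤⊤ _) (≤-trans ⊤≤ (root-≤-D i))))
          (proj₁ θ-index , λ le′ → β<β′ (≤-respˡ-≈ D-θ (≤-trans le′ (root-≤-D _)))))
        where
        D-θ : v (β′ - ϑ (proj₁ θ-index)) ≈∞ D β′
        D-θ = ≈-trans (v-sub-comm β′ _) (v-cong (+-congʳ (sym (proj₂ θ-index))))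

      weight-mono : ∀ {β′} φ′ → IsMinimalPolynomial β′ φ′ → D β ≤∞ D β′ → w φ ≤∞ w φ′
      weight-mono φ′ φ′-min le = N-mono⇒w-mono φ φ′ minimal φ′-min (D-mono⇒N-mono le)

      distance-mono : ∀ {β′} φ′ → IsMinimalPolynomial β′ φ′ → w φ′ ≤∞ w φ → D β′ ≤∞ D β
      distance-mono φ′ φ′-min le = N-mono⇒D-mono (w-mono⇒N-mono φ′ φ φ′-min minimal le)

      weight-strict : ∀ {β′} φ′ → IsMinimalPolynomial β′ φ′ → D β <∞ D β′ → w φ <∞ w φ′
      weight-strict φ′ φ′-min lt = G.≰⇒> (G.<⇒≱ lt ∘ distance-mono φ′ φ′-min)

      distance-strict : ∀ {β′} φ′ → IsMinimalPolynomial β′ φ′ → w φ′ <∞ w φ → D β′ <∞ D β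
      distance-strict φ′ φ′-min lt = G.≰⇒> (G.<⇒≱ lt ∘ weight-mono φ′ φ′-min)

    -- This reduces questions about weights of arbitrary monic `g` to irreducible polynomials of no
    -- larger degree, where weight and distance can be compared.
    weight-bound : ∀ g → ∃[ φ ] ∃[ β ] IsNearestConjugate φ β × deg φ ℕ.≤ deg g × w g ≤∞ w φ
    weight-bound g =
      let (βs , roots , e) = weight-sum g
          (j , le)         = G.average-≤ (N ∘ βs) (≤-reflexive e)
          (φ , φ-min)      = minimal-polynomial (βs j)
          (β , β-near)     = nearest-conjugate φ φ-min
      in φ , β , β-near , proj₂ φ-min g (roots j) ,
         G.·-cancel-≤ (degree-1 F) (≤-respʳ-≈ (≈-sym (minimal-weight φ φ-min)) le)

    HasMax-V⇒W : ∀ {m} → HasMax (V m) → HasMax (W m)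
    HasMax-V⇒W {m} (x , (β , (k , (φ , φ-min , degφ≡k) , k<m) , x≈Dβ) , max) =
      w φ , (φ , ≡.subst (_< m) (≡.sym degφ≡k) k<m , ≈-refl) , λ (g , g<m , y≈wg) → bound g g<m y≈wg
      where
      bound : ∀ {y} g → deg g < m → y ≈∞ w g → y ≤∞ w φ
      bound g g<m y≈wg =
        let (φ′ , β′ , β′-near , φ′≤g , wg≤wφ′) = weight-bound g
        in ≤-trans (≤-respˡ-≈ (≈-sym y≈wg) wg≤wφ′)
          (weight-mono φ′ β′-near φ φ-min (≤-respʳ-≈ x≈Dβ
            (max (β′ , (deg φ′ , (φ′ , IsNearestConjugate.minimal β′-near , ≡.refl) , ℕ.≤-<-trans φ′≤g g<m) , ≈-refl))))

    -- A polynomial `g` of maximal weight may be reducible; `weight-bound` replaces it by an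
    -- irreducible one, whose nearest root realises the maximal distance.
    HasMax-W⇒V : ∀ {m} → HasMax (W m) → HasMax (V m)
    HasMax-W⇒V {m} (x , (g , g<m , x≈wg) , max) =
      let (φ , β , β-near , φ≤g , wg≤wφ) = weight-bound g
      in D β , (β , (deg φ , (φ , IsNearestConjugate.minimal β-near , ≡.refl) , ℕ.≤-<-trans φ≤g g<m) , ≈-refl) ,
      λ { (β′ , (k , (φ′ , φ′-min , degφ′≡k) , k<m) , y≈Dβ′) → ≤-respˡ-≈ (≈-sym y≈Dβ′)
            (distance-mono φ β-near φ′ φ′-min (≤-trans
              (≤-respʳ-≈ x≈wg (max (φ′ , ≡.subst (_< m) (≡.sym degφ′≡k) k<m , ≈-refl))) wg≤wφ)) }

    -- From Okutsu sequences to Okutsu frames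

    module _ {p r} {A : Fin (suc r) → Pred Carrier p} (sequence : IsOkutsuSequence r A) where
      open IsOkutsuSequence sequence

      private
        dominating : ∀ l {β} φ → IsNearestConjugate φ β → deg φ < m (suc l) →
                     ∃[ α ] α ∈ A (inject₁ l) × D β ≤∞ D α
        dominating l φ (nearestConjugate φ-min _) = OS0 l (φ , φ-min , ≡.refl)

        minimal-degree : ∀ i {α φ} → α ∈ A i → IsMinimalPolynomial α φ → deg φ ≡ m i
        minimal-degree i {φ = φ} α∈A φ-min =
          let (φ′ , φ′-min , degφ′≡m) = degree i α∈A
          in ≡.trans (minimal-deg φ φ′ φ-min φ′-min) degφ′≡m

      minimalPolynomials-preFrame : IsPreOkutsuFrame r (λ i → MinimalPolynomials (A i))
      minimalPolynomials-preFrame = record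
        { Φ⊆Irr    = λ { i {φ} (α , _ , φ-min) → minimal⇒Irr φ φ-min }
        ; Φ-resp-≈ = λ { i {φ} {ψ} φ≈ψ (α , α∈A , φ-min) → α , α∈A , minimal-resp-≈ₘ {f = φ} {ψ} φ≈ψ φ-min }
        ; Φ-last   = (λ { {φ} (α , α∈A , φ-min) →
                            minimal-unique φ F (minimal-resp-≈ φ (proj₁ A-last α∈A) φ-min) F-min })
                   , (λ {φ} φ≈F → θ , proj₂ A-last refl , minimal-resp-≈ₘ {f = F} {φ} (≈ₘ-sym {φ} {F} φ≈F) F-min)
        ; m        = m
        ; nonempty = λ i → let (α , α∈A) = nonempty i; (φ , φ-min , _) = degree i α∈A in φ , α , α∈A , φ-min
        ; degree   = λ { i {φ} (α , α∈A , φ-min) → minimal-degree i {φ = φ} α∈A φ-min }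
        ; m-first  = m-first
        ; m-mono   = m-mono
        ; m-last   = m-last
        ; OF0      = OF0
        ; OF1      = λ { l hasMax {φ} {φ′} (α , α∈A , φ-min) (α′ , α′∈A , φ′-min) →
                         minimal-unique φ φ′ (minimal-resp-≈ φ (OS1 l (HasMax-W⇒V hasMax) α∈A α′∈A) φ-min) φ′-min }
        ; OF3      = OF3
        }
        where
        OF0 : ∀ l g → deg g < m (suc l) → ∃[ φ ] φ ∈ MinimalPolynomials (A (inject₁ l)) × w g ≤∞ w φ
        OF0 l g g<m =
          let (φ , β , β-near , φ≤g , wg≤wφ) = weight-bound g
              (α , α∈A , Dβ≤Dα)              = dominating l φ β-near (ℕ.≤-<-trans φ≤g g<m)
              (ψ , ψ-min , _)                = degree (inject₁ l) α∈A
          -- `α` need not be nearest among its conjugates; only `β`, on the side of the smaller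
          -- distance, has to be.
          in ψ , (α , α∈A , ψ-min) , ≤-trans wg≤wφ (weight-mono φ β-near ψ ψ-min Dβ≤Dα)

        -- OS3 for `α` is not enough, since the weight of `φ` is governed by a conjugate `β` that
        -- may be closer to `θ`. As `β` has the same degree, OS0 dominates it by some `α′` in the
        -- same set, and OS3 applies to `α′`.
        OF3 : ∀ l {φ ψ} → φ ∈ MinimalPolynomials (A (inject₁ l)) → ψ ∈ MinimalPolynomials (A (suc l)) → w φ <∞ w ψ
        OF3 l {φ} {ψ} (α , α∈A , φ-min) (γ , γ∈A , ψ-min) =
          let (β , β-near)         = nearest-conjugate φ φ-min
              degφ<m               = ≡.subst (_< m (suc l)) (≡.sym (minimal-degree (inject₁ l) {φ = φ} α∈A φ-min)) (m-mono l)
              (α′ , α′∈A , Dβ≤Dα′) = dominating l φ β-near degφ<m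
          in weight-strict φ β-near ψ ψ-min (G.≰⇒> λ Dγ≤Dβ →
               G.<⇒≱ (OS3 l α′∈A γ∈A) (≤-trans Dγ≤Dβ Dβ≤Dα′))

      minimalPolynomials-frame : (∀ i → AttainsDistance (A i)) → IsOkutsuFrame r (λ i → MinimalPolynomials (A i))
      minimalPolynomials-frame attains = record
        { isPreOkutsuFrame = minimalPolynomials-preFrame
        ; OF2 = OF2 }
        where
        near : ∀ i {α} φ → α ∈ A i → IsMinimalPolynomial α φ → IsNearestConjugate φ α
        near i φ α∈A φ-min = nearestConjugate φ-min λ {β′} root →
          proj₂ (attains i {φ = φ} α∈A φ-min) (β′ , root , ≈-refl)

        OF2 : ∀ l → ¬ HasMax (W (m (suc l))) → ∀ {φ φ′} →
              φ ∈ MinimalPolynomials (A (inject₁ l)) → φ′ ∈ MinimalPolynomials (A (inject₁ l)) →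
              w φ <∞ w φ′ ⊎ φ ≈ₘ φ′ ⊎ w φ′ <∞ w φ
        OF2 l noMax {φ} {φ′} (α , α∈A , φ-min) (α′ , α′∈A , φ′-min) =
          -- `weight-strict` needs nearness at the smaller distance. Either element may be that one,
          -- so `attains` is used for both.
          Sum.map (weight-strict φ (near _ φ α∈A φ-min) φ′ φ′-min)
            (Sum.map (λ α≈α′ → minimal-unique φ φ′ (minimal-resp-≈ φ α≈α′ φ-min) φ′-min)
                     (weight-strict φ′ (near _ φ′ α′∈A φ′-min) φ φ-min))
            (OS2 l (noMax ∘ HasMax-V⇒W) α∈A α′∈A)

    -- From Okutsu frames to Okutsu sequences

    module _ {p r} {Φ : Fin (suc r) → Pred Monic p} (frame : IsOkutsuFrame r Φ)
             (choice : ∀ i → RootChoice (Φ i)) where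
      open IsOkutsuFrame frame
      private
        module C i = RootChoice (choice i)

        near : ∀ i {α} φ (φ∈Φ : φ ∈ Φ i) → α ≈ C.root i φ φ∈Φ → IsNearestConjugate φ α
        near i φ φ∈Φ α≈root = nearestConjugate
          (Irr⇒minimal φ (Φ⊆Irr i φ∈Φ) (trans (ev-respʳ (toPoly φ) α≈root) (C.isRoot i φ φ∈Φ)))
          λ {β′} root → ≤-respʳ-≈ (≈-sym (D-cong α≈root)) (proj₂ (C.distance i φ φ∈Φ) (β′ , root , ≈-refl))

      roots-sequence : IsOkutsuSequence r (λ i → C.Roots i)
      roots-sequence = record
        { A-resp-≈ = λ { i α≈β (φ , φ∈Φ , α≈root) → φ , φ∈Φ , trans (sym α≈β) α≈root }
        -- `θ` is itself a root of `F`, so the chosen nearest root is at distance ∞ from `θ`, hence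
        -- equal to it.
        ; A-last   = (λ { {α} (φ , φ∈Φ , α≈root) → sym (x∙y⁻¹≈ε⇒x≈y _ _ (v≈⊤⇒≈0 (≤-trans
                            (≈0⇒v≈⊤ (-‿inverseʳ θ)) (IsNearestConjugate.nearest (near (fromℕ r) φ φ∈Φ α≈root)
                              (trans (≈ₘ-eval {φ} {F} (proj₁ Φ-last φ∈Φ) θ) (proj₁ F-min)))))) })
                   , (λ {α} α≈θ → let F∈Φ = proj₂ Φ-last {F} (λ _ → K.refl) in
                        F , F∈Φ , trans α≈θ (x∙y⁻¹≈ε⇒x≈y _ _ (v≈⊤⇒≈0 (≤-trans
                          (≈0⇒v≈⊤ (-‿inverseʳ θ)) (IsNearestConjugate.nearest (near (fromℕ r) F F∈Φ refl) (proj₁ F-min))))))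
        ; m        = m
        ; nonempty = λ i → let (φ , φ∈Φ) = nonempty i in C.root i φ φ∈Φ , φ , φ∈Φ , refl
        ; degree   = λ { i (φ , φ∈Φ , α≈root) →
                         φ , IsNearestConjugate.minimal (near i φ φ∈Φ α≈root) , degree i φ∈Φ }
        ; m-first  = m-first
        ; m-mono   = m-mono
        ; m-last   = m-last
        ; OS0      = OS0
        ; OS1      = λ { l hasMax (φ , φ∈Φ , α≈root) (φ′ , φ′∈Φ , α′≈root) →
                         trans α≈root (trans (C.cong (inject₁ l) φ∈Φ φ′∈Φ (OF1 l (HasMax-V⇒W hasMax) φ∈Φ φ′∈Φ)) (sym α′≈root)) }
        ; OS2      = OS2
        -- Nearness is used for the root of `ψ`, the polynomial of larger weight.
        ; OS3      = λ { l (φ , φ∈Φ , α≈root) (ψ , ψ∈Φ , γ≈root) → distance-strict ψ (near (suc l) ψ ψ∈Φ γ≈root) φ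
                         (IsNearestConjugate.minimal (near (inject₁ l) φ φ∈Φ α≈root)) (OF3 l φ∈Φ ψ∈Φ) }
        }
        where
        -- OF0 is applied to the minimal polynomial of `β`. The chosen root of the dominating `φ` is
        -- nearest, so the inequality of weights yields one of distances.
        OS0 : ∀ l {β k} → HasDegree β k → k < m (suc l) →
              ∃[ α ] α ∈ C.Roots (inject₁ l) × D β ≤∞ D α
        OS0 l {β} (ψ , ψ-min , degψ≡k) k<m =
          let (φ , φ∈Φ , wψ≤wφ) = OF0 l ψ (≡.subst (_< m (suc l)) (≡.sym degψ≡k) k<m)
              α                 = C.root (inject₁ l) φ φ∈Φ
          in α , (φ , φ∈Φ , refl) , distance-mono φ (near (inject₁ l) φ φ∈Φ refl) ψ ψ-min wψ≤wφ

        OS2 : ∀ l → ¬ HasMax (V (m (suc l))) → ∀ {α α′} →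
              α ∈ C.Roots (inject₁ l) → α′ ∈ C.Roots (inject₁ l) → D α <∞ D α′ ⊎ α ≈ α′ ⊎ D α′ <∞ D α
        OS2 l noMax (φ , φ∈Φ , α≈root) (φ′ , φ′∈Φ , α′≈root) =
          Sum.map (distance-strict φ′ φ′-near φ (IsNearestConjugate.minimal φ-near))
            (Sum.map (λ φ≈φ′ → trans α≈root (trans (C.cong (inject₁ l) φ∈Φ φ′∈Φ φ≈φ′) (sym α′≈root)))
                     (distance-strict φ φ-near φ′ (IsNearestConjugate.minimal φ′-near)))
            (OF2 l (noMax ∘ HasMax-W⇒V) φ∈Φ φ′∈Φ)
          where
          φ-near  = near (inject₁ l) φ φ∈Φ α≈root
          φ′-near = near (inject₁ l) φ′ φ′∈Φ α′≈root

theorem3p4 : (∀ {a} → ExcludedMiddle a) →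
    ∀ {c ℓ g₁ g₂ g₃ p} (K : Field c ℓ) (Γ : OrderedAbelianGroup g₁ g₂ g₃)
    (vK : Valuation K Γ) → Henselian vK →
    (K̄ : ValuedAlgebraicClosure vK) →
    let open ValuedAlgebraicClosure K̄ in
    let open Polynomial (Field.commutativeRing K) in
    (θ : Field.Carrier overfield) (F : Monic) →
    IsMinimalPolynomial θ F → 1 < deg F →
    let open Okutsu K̄ θ F in
    (∀ r (A : Fin (suc r) → Pred (Field.Carrier overfield) p) →
    IsOkutsuSequence r A →
    IsPreOkutsuFrame r (λ i → MinimalPolynomials (A i)) ×
    ((∀ i → AttainsDistance (A i)) →
    IsOkutsuFrame r (λ i → MinimalPolynomials (A i))))
    ×
    (∀ r (Φ : Fin (suc r) → Pred Monic p) → IsOkutsuFrame r Φ →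
    (α : ∀ i → RootChoice (Φ i)) →
    IsOkutsuSequence r (λ i → RootChoice.Roots (α i)))
theorem3p4 em K Γ vK henselian K̄ θ F F-min _ =
  (λ r A sequence → minimalPolynomials-preFrame θ F F-min sequence , minimalPolynomials-frame θ F F-min sequence) ,
  (λ r Φ frame α → roots-sequence θ F F-min frame α)
  where open WeightsAndDistances em henselian K̄
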